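{- Let $\mathcal{H}_3$ be the class of $2$-vertex $n$-extremal minimal bipartite matching covered graphs and $\mathcal{H}_4$ the class of edge extremal minimal bipartite matching covered graphs. Then $\mathcal{H}_4\cap\mathcal{H}_3=\{\Theta\}$ (up to isomorphism).
   Context: All graphs are finite and loopless; parallel edges are allowed. For a graph $G=(V,E)$ write $n=|V|$. A connected graph on four or more vertices is matching covered if every edge lies in some perfect matching. A matching covered graph is minimal if deleting any single edge yields a graph that is not matching covered. $V_2$ is the set of vertices of degree two. A minimal bipartite matching covered graph is $2$-vertex $n$-extremal if $|V_2|=\frac n2+2$, and edge extremal if $|E|=\frac{3n-6}{2}$. $\Theta$ is the graph on $8$ vertices and $9$ edges consisting of two vertices joined by three internally disjoint paths, each of length three. -}

module Defs where

open import Data.Bool.Base using (Bool)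
open import Data.Fin.Base using (Fin; punchIn)
open import Data.Fin.Patterns
open import Data.Fin.Properties using (_≟_; all?)
open import Data.Fin.Subset using (Subset; _∈_)
open import Data.List.Base using (List; allFin; filter; length)
open import Data.Nat.Base using (ℕ; zero; suc; _+_; _*_; _≤_)
import Data.Nat.Properties as ℕₚ
open import Data.Product.Base using (_×_; _,_; proj₁; proj₂; ∃; ∃-syntax)
open import Data.Product using (∃!)
open import Data.Sum.Base using (_⊎_)
open import Data.Vec.Base using (Vec; []; _∷_; lookup)
open import Function.Base using (_∘_)
open import Function.Bundles using (_↔_; Inverse)
open import Relation.Binary.Construct.Closure.ReflexiveTransitive using (Star)
open import Relation.Binary.Definitions using (Decidable)
open import Relation.Binary.PropositionalEquality using (_≡_; _≢_)
open import Relation.Nullary using (¬_)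
open import Relation.Nullary.Decidable using (_⊎-dec_; ¬?; from-yes)

-- Parallel edges are distinct indices with the same ends. The order of the
-- two ends of an edge carries no meaning: see Joins.
record Graph : Set where
  field
    order    : ℕ
    size     : ℕ
    ends     : Fin size → Fin order × Fin order
    loopless : ∀ e → proj₁ (ends e) ≢ proj₂ (ends e)

  Vertex : Set
  Vertex = Fin order

  Edge : Set
  Edge = Fin size

  Joins : Edge → Vertex → Vertex → Set
  Joins e u v = ends e ≡ (u , v) ⊎ ends e ≡ (v , u)

  Incident : Vertex → Edge → Set
  Incident v e = proj₁ (ends e) ≡ v ⊎ proj₂ (ends e) ≡ v

  incident? : Decidable Incident
  incident? v e = (proj₁ (ends e) ≟ v) ⊎-dec (proj₂ (ends e) ≟ v)

  -- Counting incident edges is the degree because there are no loops.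
  degree : Vertex → ℕ
  degree v = length (filter (incident? v) (allFin size))

  V₂ : List Vertex
  V₂ = filter (λ v → degree v ℕₚ.≟ 2) (allFin order)

  Adjacent : Vertex → Vertex → Set
  Adjacent u v = ∃[ e ] Joins e u v

  Connected : Set
  Connected = ∀ u v → Star Adjacent u v

  Bipartite : Set
  Bipartite = ∃ λ (colour : Vertex → Bool) →
    ∀ e → colour (proj₁ (ends e)) ≢ colour (proj₂ (ends e))

  PerfectMatching : Subset size → Set
  PerfectMatching M = ∀ v → ∃! _≡_ (λ e → e ∈ M × Incident v e)

  MatchingCovered : Set
  MatchingCovered =
    Connected × 4 ≤ order × (∀ e → ∃[ M ] PerfectMatching M × e ∈ M)

open Graph using (Edge)

infixl 6 _-ₑ_

_-ₑ_ : (G : Graph) → Edge G → Graph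
record { size = zero } -ₑ ()
record { order = n ; size = suc m ; ends = ends ; loopless = loopless } -ₑ e = record
  { order    = n
  ; size     = m
  ; ends     = ends ∘ punchIn e
  ; loopless = loopless ∘ punchIn e
  }

Minimal : Graph → Set
Minimal G = ∀ e → ¬ Graph.MatchingCovered (G -ₑ e)

MinimalBipartiteMatchingCovered : Graph → Set
MinimalBipartiteMatchingCovered G =
  Graph.Bipartite G × Graph.MatchingCovered G × Minimal G

-- |V₂| = n/2 + 2, with denominators cleared so that no division truncates.
H₃ : Graph → Set
H₃ G = MinimalBipartiteMatchingCovered G × 2 * length V₂ ≡ order + 4
  where open Graph G

-- |E| = (3n - 6)/2, cleared of denominators and of subtraction likewise.
H₄ : Graph → Set
H₄ G = MinimalBipartiteMatchingCovered G × 2 * size + 6 ≡ 3 * order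
  where open Graph G

infix 4 _≅_

record _≅_ (G H : Graph) : Set where
  private
    module G = Graph G
    module H = Graph H
  field
    vertices : G.Vertex ↔ H.Vertex
    edges    : G.Edge ↔ H.Edge
    joins    : ∀ {e u v} → G.Joins e u v →
               H.Joins (Inverse.to edges e) (Inverse.to vertices u) (Inverse.to vertices v)

-- The branch vertices are 0 and 1; each row is one path from 0 to 1.
Θ : Graph
Θ = record
  { order    = 8
  ; size     = 9
  ; ends     = Θ-ends
  ; loopless = from-yes (all? λ e → ¬? (proj₁ (Θ-ends e) ≟ proj₂ (Θ-ends e)))
  }
  where
  Θ-ends : Fin 9 → Fin 8 × Fin 8
  Θ-ends = lookup
    ( (0F , 2F) ∷ (2F , 3F) ∷ (3F , 1F)
    ∷ (0F , 4F) ∷ (4F , 5F) ∷ (5F , 1F)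
    ∷ (0F , 6F) ∷ (6F , 7F) ∷ (7F , 1F)
    ∷ [])

{-# OPTIONS --safe #-}

-- Fix a perfect matching of G and contract its n/2 = N edges: G becomes a strongly
-- connected digraph D in which, by minimality, no arc has a detour, and |E| = (3n − 6)/2
-- says that D has 2N − 3 arcs.  Spanning D from a strongly connected part with s nodes and
-- a arcs by an out-branching and an in-branching gives 2s ≤ a + 3.  Hence D has no cycle
-- longer than three, and two triangles that meet share an arc.  A 2-cycle of D is a 4-cycle
-- of G; switching the matching along it exposes a removable edge, so D has none.  Thus
-- either D is a triangle, or D consists of one arc q → p and the paths p → x → q for all
-- other nodes x, and at most two vertices of G have degree other than two.  Now
-- |V₂| = n/2 + 2 leaves only N = 4, and D is the contraction of Θ.

module Submission where

open import Defs
open import Data.Bool.Base using (true; false)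
import Data.Bool.Properties as Bool
open import Data.Empty using (⊥; ⊥-elim)
open import Data.Fin.Base using (Fin; zero; suc; punchIn; punchOut; toℕ)
open import Data.Fin.Patterns
open import Data.Fin.Permutation as Perm using (Permutation′; _⟨$⟩ʳ_; _⟨$⟩ˡ_; _∘ₚ_)
open import Data.Fin.Permutation.Components using (transpose; transpose-inverse)
open import Data.Fin.Properties using (_≟_; all?; any?; injective⇒≤; pigeonhole; punchIn-punchOut)
import Data.Fin.Subset as Subset
open Subset using (Subset)
open import Data.Fin.Subset.Properties using () renaming (_∈?_ to _∈ˢ?_)
open import Data.List.Base using (List; []; _∷_; _++_; length; lookup; allFin; filter; map)
open import Data.List.Membership.Propositional using (_∈_; _∉_)
open import Data.List.Membership.Propositional.Properties
  using (∈-allFin; ∈-lookup; ∈-++⁺ˡ; ∈-++⁺ʳ; ∈-filter⁺; ∈-filter⁻; ∈-map⁺; ∈-map⁻)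
open import Data.List.Properties using (length-tabulate; length-++; length-map)
open import Data.List.Relation.Unary.All as All using ([]; _∷_)
open import Data.List.Relation.Unary.All.Properties using (¬Any⇒All¬)
open import Data.List.Relation.Unary.AllPairs using ([]; _∷_)
open import Data.List.Relation.Unary.Any using (here; there; index)
open import Data.List.Relation.Unary.Any.Properties using (lookup-index)
open import Data.List.Relation.Unary.Unique.Propositional using (Unique)
open import Data.List.Relation.Unary.Unique.Propositional.Properties
  using (allFin⁺; filter⁺; map⁺; ++⁺)
open import Data.Nat.Base using (ℕ; zero; suc; _+_; _*_; _∸_; _≤_; _<_; z≤n; s≤s)
open import Data.Nat.GeneralisedArithmetic using (fold)
open import Data.Nat.Properties hiding (_≟_)
import Data.Nat.Properties as ℕ
open import Data.Nat.Tactic.RingSolver using (solve-∀)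
open import Data.Product.Base using (_×_; _,_; proj₁; proj₂; ∃-syntax)
open import Data.Sum.Base using (_⊎_; inj₁; inj₂; [_,_])
open import Data.Vec.Base as Vec using ([]; _∷_)
open import Data.Vec.Properties using (lookup∘tabulate; []=⇒lookup; lookup⇒[]=)
open import Function.Base using (_∘_; id)
open import Function.Bundles using (_↔_; Inverse; mk↔ₛ′)
open import Function.Construct.Symmetry using (↔-sym)
open import Relation.Binary.Construct.Closure.ReflexiveTransitive as Star
  using (Star; ε; _◅_; _◅◅_)
open import Relation.Binary.PropositionalEquality hiding ([_])
open import Relation.Nullary using (¬_; Dec; yes; no; does; contradiction)
open import Relation.Nullary.Decidable
  using (¬?; _×-dec_; _⊎-dec_; _→-dec_; decidable-stable; dec-true; from-yes)
open import Relation.Unary using (Decidable; _∩_; _≐_)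

-- Finite enumerations

-- The constant in 2s ≤ a + 3: the two branchings add N - s arcs each, and any arc outside the part
-- and both branchings would have a detour, so 2N - 3 ≤ a + 2(N - s). A cycle has s = a, hence s ≤
-- 3. Two triangles with a single common node have s = 5 and a = 6, which is one arc too few; two
-- triangles with a common arc have s = 4 and a = 5, which is tight. This count cannot exclude
-- 2-cycles: a 2-cycle and a triangle with one common node have four nodes, five arcs and no detour.
-- What the contraction hides is that minimality also concerns the matched edges. The detour
-- condition is therefore proved for every perfect matching. A walk that leaves the 2-cycle at x and
-- first meets it again at x is harmless for the given matching, but for the switched one it is a
-- detour for the edge formerly contracted to x. For the converse inclusion both classes are shown
-- to be closed under isomorphism, so that only Θ itself has to be checked.

lookup-injective : ∀ {A : Set} {xs : List A} → Unique xs →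
                   ∀ {i j} → lookup xs i ≡ lookup xs j → i ≡ j
lookup-injective (_ ∷ _)   {zero}  {zero}  _  = refl
lookup-injective (x∉ ∷ _)  {zero}  {suc j} eq = contradiction eq (All.lookup x∉ (∈-lookup j))
lookup-injective (x∉ ∷ _)  {suc i} {zero}  eq = contradiction (sym eq) (All.lookup x∉ (∈-lookup i))
lookup-injective (_ ∷ xs!) {suc i} {suc j} eq = cong suc (lookup-injective xs! eq)

Unique-⊆⇒length≤ : ∀ {A : Set} {xs ys : List A} → Unique xs →
                   (∀ {x} → x ∈ xs → x ∈ ys) → length xs ≤ length ys
Unique-⊆⇒length≤ {xs = xs} {ys} xs! xs⊆ys = injective⇒≤ {f = position} λ {i} {j} eq →
  lookup-injective xs! (trans (lookup-index (xs⊆ys (∈-lookup i)))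
    (trans (cong (lookup ys) eq) (sym (lookup-index (xs⊆ys (∈-lookup j))))))
  where
  position : Fin (length xs) → Fin (length ys)
  position i = index (xs⊆ys (∈-lookup i))

∉⇒Unique-∷ : ∀ {A : Set} {x : A} {xs} → x ∉ xs → Unique xs → Unique (x ∷ xs)
∉⇒Unique-∷ x∉xs xs! = ¬Any⇒All¬ _ x∉xs ∷ xs!

module _ {n : ℕ} where

  open import Data.List.Membership.DecPropositional (_≟_ {n}) using (_∈?_)

  Unique⇒length≤ : {xs : List (Fin n)} → Unique xs → length xs ≤ n
  Unique⇒length≤ xs! = ≤-trans (Unique-⊆⇒length≤ xs! (λ {x} _ → ∈-allFin x))
    (≤-reflexive (length-tabulate id))

  complete⇒length≥ : {xs : List (Fin n)} → (∀ x → x ∈ xs) → n ≤ length xs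
  complete⇒length≥ all∈ = ≤-trans (≤-reflexive (sym (length-tabulate id)))
    (Unique-⊆⇒length≤ (allFin⁺ n) (λ {x} _ → all∈ x))

  complete⇒length≡ : {xs : List (Fin n)} → Unique xs → (∀ x → x ∈ xs) → length xs ≡ n
  complete⇒length≡ xs! all∈ = ≤-antisym (Unique⇒length≤ xs!) (complete⇒length≥ all∈)

  length<⇒missing : {xs : List (Fin n)} → length xs < n → ∃[ x ] x ∉ xs
  length<⇒missing {xs} lt with any? (λ x → ¬? (x ∈? xs))
  ... | yes missing = missing
  ... | no ¬missing = contradiction
    (≤-trans lt (complete⇒length≥ λ x → decidable-stable (x ∈? xs) (λ x∉ → ¬missing (x , x∉))))
    (<-irrefl refl)

  Unique∧length≡⇒complete : {xs : List (Fin n)} → Unique xs → length xs ≡ n → ∀ x → x ∈ xs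
  Unique∧length≡⇒complete {xs} xs! eq x = decidable-stable (x ∈? xs) λ x∉ →
    <-irrefl refl (≤-trans (≤-reflexive (cong suc (sym eq))) (Unique⇒length≤ (∉⇒Unique-∷ x∉ xs!)))

-- Digraphs

-- Source and target are parameters so that exchanging them turns an out-branching into an
-- in-branching.
module Growth {N k : ℕ} (s t : Fin k → Fin N)
              (strong : ∀ u v → Star (λ x y → ∃[ f ] s f ≡ x × t f ≡ y) u v) where

  open import Data.List.Membership.DecPropositional (_≟_ {N}) using (_∈?_)

  Via : List (Fin k) → Fin N → Fin N → Set
  Via F x y = ∃[ f ] f ∈ F × s f ≡ x × t f ≡ y

  exit : ∀ {R u v} → Star (λ x y → ∃[ f ] s f ≡ x × t f ≡ y) u v → u ∈ R → v ∉ R →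
         ∃[ f ] s f ∈ R × t f ∉ R
  exit ε u∈ v∉ = contradiction u∈ v∉
  exit {R} ((f , refl , refl) ◅ w) u∈ v∉ with t f ∈? R
  ... | yes t∈ = exit w t∈ v∉
  ... | no  t∉ = f , u∈ , t∉

  weaken : ∀ {f F x y} → Star (Via F) x y → Star (Via (f ∷ F)) x y
  weaken = Star.map λ (g , g∈ , eqs) → g , there g∈ , eqs

  -- Each round adds an arc that leaves the nodes reached so far, hence one arc and one new node.
  -- That `F` has exactly `j` arcs is what the count in `arcs≥` needs.
  grow : ∀ {S r} → Unique S → r ∈ S → ∀ j → j + length S ≤ N →
         ∃[ R ] ∃[ F ] Unique R × length R ≡ j + length S × length F ≡ j × r ∈ R ×
           (∀ {x} → x ∈ R → ∃[ y ] y ∈ S × Star (Via F) y x)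
  grow {S} S! r∈ zero _ = S , [] , S! , refl , refl , r∈ , λ x∈ → _ , x∈ , ε
  grow {S} {r} S! r∈ (suc j) le
    with R , F , R! , R≡ , F≡ , r∈R , reach ← grow S! r∈ j (≤-trans (n≤1+n _) le)
    with x , x∉ ← length<⇒missing {xs = R} (≤-trans (s≤s (≤-reflexive R≡)) le)
    with f , s∈ , t∉ ← exit (strong r x) r∈R x∉
    = t f ∷ R , f ∷ F , ∉⇒Unique-∷ t∉ R! , cong suc R≡ , cong suc F≡ , there r∈R , reach′
    where
    reach′ : ∀ {x} → x ∈ t f ∷ R → ∃[ y ] y ∈ S × Star (Via (f ∷ F)) y x
    reach′ (here refl) with y , y∈ , w ← reach s∈ =
      y , y∈ , weaken w ◅◅ ((f , here refl , refl , refl) ◅ ε)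
    reach′ (there x∈) with y , y∈ , w ← reach x∈ = y , y∈ , weaken w

  span : ∀ {S r} → Unique S → r ∈ S →
         ∃[ F ] length F + length S ≡ N × (∀ x → ∃[ y ] y ∈ S × Star (Via F) y x)
  span {S} S! r∈ with R , F , R! , R≡ , F≡ , _ , reach ← grow S! r∈ (N ∸ length S)
                       (≤-reflexive (m∸n+n≡m (Unique⇒length≤ S!)))
    = F , trans (cong (_+ length S) F≡) N≡
    , λ x → reach (Unique∧length≡⇒complete R! (trans R≡ N≡) x)
    where
    N≡ : N ∸ length S + length S ≡ N
    N≡ = m∸n+n≡m (Unique⇒length≤ S!)

module Digraph {N k : ℕ} (src tgt : Fin k → Fin N) where

  infix 4 _⟶_

  _⟶_ : Fin N → Fin N → Set
  u ⟶ v = ∃[ f ] src f ≡ u × tgt f ≡ v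

  Via : List (Fin k) → Fin N → Fin N → Set
  Via F u v = ∃[ f ] f ∈ F × src f ≡ u × tgt f ≡ v

  Avoiding : Fin k → Fin N → Fin N → Set
  Avoiding f u v = ∃[ g ] g ≢ f × src g ≡ u × tgt g ≡ v

  StronglyConnected : Set
  StronglyConnected = ∀ u v → Star _⟶_ u v

  Irredundant : Set
  Irredundant = ∀ f → ¬ Star (Avoiding f) (src f) (tgt f)

  widen : ∀ {F F′ u v} → (∀ {f} → f ∈ F → f ∈ F′) → Star (Via F) u v → Star (Via F′) u v
  widen F⊆F′ = Star.map λ (f , f∈ , eqs) → f , F⊆F′ f∈ , eqs

  -- The end `v` is a parameter because paths are shortened, and later rotated, from the front. The
  -- nodes and arcs are indices so that both can be counted.
  data SimplePath (v : Fin N) : Fin N → List (Fin N) → List (Fin k) → Set where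
    stop : SimplePath v v (v ∷ []) []
    step : ∀ {u w xs fs} (a : u ⟶ w) → SimplePath v w xs fs → u ∉ xs →
           SimplePath v u (u ∷ xs) (proj₁ a ∷ fs)

  module _ {v : Fin N} where

    open import Data.List.Membership.DecPropositional (_≟_ {N}) using (_∈?_)

    suffix : ∀ {u xs fs x} → SimplePath v u xs fs → x ∈ xs → ∃[ ys ] ∃[ gs ] SimplePath v x ys gs
    suffix p@stop         (here refl) = _ , _ , p
    suffix p@(step _ _ _) (here refl) = _ , _ , p
    suffix (step _ p _)   (there x∈)  = suffix p x∈

    simplify : ∀ {u} → Star _⟶_ u v → ∃[ xs ] ∃[ fs ] SimplePath v u xs fs
    simplify ε = _ , _ , stop
    simplify {u} (a ◅ w) with xs , fs , p ← simplify w with u ∈? xs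
    ... | yes u∈ = suffix p u∈
    ... | no  u∉ = _ , _ , step a p u∉

    path-Unique : ∀ {u xs fs} → SimplePath v u xs fs → Unique xs
    path-Unique stop          = [] ∷ []
    path-Unique (step _ p u∉) = ∉⇒Unique-∷ u∉ (path-Unique p)

    path-length : ∀ {u xs fs} → SimplePath v u xs fs → length xs ≡ suc (length fs)
    path-length stop         = refl
    path-length (step _ p _) = cong suc (path-length p)

    path-start : ∀ {u xs fs} → SimplePath v u xs fs → u ∈ xs
    path-start stop         = here refl
    path-start (step _ _ _) = here refl

    path-through : ∀ {u xs fs x} → SimplePath v u xs fs → x ∈ xs →
                   Star (Via fs) u x × Star (Via fs) x v
    path-through stop           (here refl) = ε , ε
    path-through (step a q _) (here refl) =
      ε , (_ , here refl , proj₂ a) ◅ widen there (proj₂ (path-through q (path-start q)))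
    path-through (step a q _) (there x∈) with to , from ← path-through q x∈ =
      (_ , here refl , proj₂ a) ◅ widen there to , widen there from

  module Sparse (strong : StronglyConnected) (irredundant : Irredundant)
                (sparse : k + 3 ≡ N + N) where

    open import Data.List.Membership.DecPropositional (_≟_ {k}) using () renaming (_∈?_ to _∈ᵃ?_)

    -- Spanning S by an out-branching and an in-branching uses two further arcs per
    -- node outside S, and by irredundancy no arc is left over.
    arcs≥ : ∀ {S F h} → Unique S → h ∈ S →
            (∀ {x} → x ∈ S → Star (Via F) h x × Star (Via F) x h) →
            length S + length S ≤ length F + 3
    arcs≥ {S} {F} {h} S! h∈ hub
      with F₁ , F₁≡ , reach₁ ← Growth.span src tgt strong S! h∈
         | F₂ , F₂≡ , reach₂ ← Growth.span tgt src
             (λ u v → Star.reverse (λ (f , s , t) → f , t , s) (strong v u)) S! h∈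
      = +-cancelˡ-≤ (a + b) _ _ (begin
          (a + b) + (c + c)   ≡⟨ shuffle a b c ⟩
          (a + c) + (b + c)   ≡⟨ cong₂ _+_ F₁≡ F₂≡ ⟩
          N + N               ≡⟨ sparse ⟨
          k + 3               ≤⟨ +-monoˡ-≤ 3 (complete⇒length≥ used) ⟩
          length L + 3        ≡⟨ cong (_+ 3) (trans (length-++ F) (cong (d +_) (length-++ F₁))) ⟩
          (d + (a + b)) + 3   ≡⟨ shuffle′ a b d ⟩
          (a + b) + (d + 3)   ∎)
      where
      open ≤-Reasoning
      L = F ++ F₁ ++ F₂
      a = length F₁
      b = length F₂
      c = length S
      d = length F

      shuffle : ∀ a b c → (a + b) + (c + c) ≡ (a + c) + (b + c)
      shuffle = solve-∀

      shuffle′ : ∀ a b d → (d + (a + b)) + 3 ≡ (a + b) + (d + 3)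
      shuffle′ = solve-∀

      fromHub : ∀ x → Star (Via L) h x
      fromHub x with y , y∈ , w ← reach₁ x =
        widen ∈-++⁺ˡ (proj₁ (hub y∈)) ◅◅ widen (∈-++⁺ʳ F ∘ ∈-++⁺ˡ) w

      toHub : ∀ x → Star (Via L) x h
      toHub x with y , y∈ , w ← reach₂ x =
        Star.reverse (λ (f , f∈ , s , t) → f , ∈-++⁺ʳ F (∈-++⁺ʳ F₁ f∈) , t , s) w
          ◅◅ widen ∈-++⁺ˡ (proj₂ (hub y∈))

      -- An arc outside `L` would have a detour inside `L`, from its source to the hub and on to its
      -- target.
      used : ∀ f → f ∈ L
      used f = decidable-stable (f ∈ᵃ? L) λ f∉ → irredundant f
        (Star.map (λ (g , g∈ , eqs) → g , (λ { refl → f∉ g∈ }) , eqs)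
          (toHub (src f) ◅◅ fromHub (tgt f)))

    no-loop : ∀ {u} → ¬ u ⟶ u
    no-loop (f , refl , eq) = irredundant f (subst (Star (Avoiding f) (src f)) (sym eq) ε)

    -- A parallel arc would be a detour of length one.
    arc-unique : ∀ f g → src f ≡ src g → tgt f ≡ tgt g → f ≡ g
    arc-unique f g s t with f ≟ g
    ... | yes f≡g = f≡g
    ... | no  f≢g = ⊥-elim (irredundant f ((g , f≢g ∘ sym , sym s , sym t) ◅ ε))

    module NoDigon (no-digon : ∀ {u v} → u ⟶ v → ¬ v ⟶ u) where

      close : ∀ {u v xs fs} → SimplePath u v xs fs → u ⟶ v → length fs ≤ 2 →
              ∃[ w ] v ⟶ w × w ⟶ u
      close stop                       uv _ = contradiction uv no-loop
      close (step vu stop _)             uv _ = contradiction vu (no-digon uv)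
      close (step vw (step wu stop _) _) _  _ = _ , vw , wu
      close (step _ (step _ (step _ _ _) _) _) _ (s≤s (s≤s ()))

      -- A simple path of l arcs from `v` back to `u` closes up to a cycle with l + 1 nodes and l +
      -- 1 arcs, so `arcs≥` gives l ≤ 2. Loops and digons being excluded, l is 2.
      triangle : ∀ {u v} → u ⟶ v → ∃[ w ] v ⟶ w × w ⟶ u
      triangle {u} {v} a@(f , refl , refl) with simplify (strong v u)
      ... | xs , fs , p = close p a (≤-pred (≤-pred (+-cancelˡ-≤ (length fs) _ _ bound)))
        where
        open ≤-Reasoning
        hub : ∀ {x} → x ∈ xs → Star (Via (f ∷ fs)) v x × Star (Via (f ∷ fs)) x v
        hub x∈ with to , from ← path-through p x∈ =
          widen there to , widen there from ◅◅ ((f , here refl , refl , refl) ◅ ε)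
        bound : length fs + (2 + length fs) ≤ length fs + 4
        bound = begin
          length fs + (2 + length fs)         ≡⟨ shuffle (length fs) ⟩
          suc (length fs) + suc (length fs)   ≡⟨ cong₂ _+_ (path-length p) (path-length p) ⟨
          length xs + length xs               ≤⟨ arcs≥ (path-Unique p) (path-start p) hub ⟩
          suc (length fs) + 3                 ≡⟨ +-suc (length fs) 3 ⟨
          length fs + 4                       ∎
          where
          shuffle : ∀ l → l + (2 + l) ≡ suc l + suc l
          shuffle = solve-∀

      -- Triangles meeting in p alone would span five nodes with only six arcs.
      share : ∀ {p q r s t} → p ⟶ q → q ⟶ r → r ⟶ p → p ⟶ s → s ⟶ t → t ⟶ p → q ≡ s ⊎ r ≡ t
      share {p} {q} {r} {s} {t} pq qr rp ps st tp with q ≟ s | r ≟ t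
      ... | yes q≡s | _       = inj₁ q≡s
      ... | no  _   | yes r≡t = inj₂ r≡t
      ... | no  q≢s | no  r≢t = contradiction (arcs≥ S! (here refl) hub) (<-irrefl refl)
        where
        apart : ∀ {u v} → u ⟶ v → u ≢ v
        apart a refl = no-loop a
        q≢t : q ≢ t
        q≢t refl = no-digon pq tp
        r≢s : r ≢ s
        r≢s refl = no-digon rp ps
        S! : Unique (p ∷ q ∷ r ∷ s ∷ t ∷ [])
        S! = (apart pq ∷ apart rp ∘ sym ∷ apart ps ∷ apart tp ∘ sym ∷ [])
           ∷ (apart qr ∷ q≢s ∷ q≢t ∷ [])
           ∷ (r≢s ∷ r≢t ∷ [])
           ∷ (apart st ∷ [])
           ∷ [] ∷ []
        F = proj₁ pq ∷ proj₁ qr ∷ proj₁ rp ∷ proj₁ ps ∷ proj₁ st ∷ proj₁ tp ∷ []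
        pq′ : Star (Via F) p q
        pq′ = (_ , here refl , proj₂ pq) ◅ ε
        qr′ : Star (Via F) q r
        qr′ = (_ , there (here refl) , proj₂ qr) ◅ ε
        rp′ : Star (Via F) r p
        rp′ = (_ , there (there (here refl)) , proj₂ rp) ◅ ε
        ps′ : Star (Via F) p s
        ps′ = (_ , there (there (there (here refl))) , proj₂ ps) ◅ ε
        st′ : Star (Via F) s t
        st′ = (_ , there (there (there (there (here refl)))) , proj₂ st) ◅ ε
        tp′ : Star (Via F) t p
        tp′ = (_ , there (there (there (there (there (here refl))))) , proj₂ tp) ◅ ε
        hub : ∀ {x} → x ∈ p ∷ q ∷ r ∷ s ∷ t ∷ [] → Star (Via F) p x × Star (Via F) x p
        hub (here refl)                                 = ε , ε
        hub (there (here refl))                         = pq′ , qr′ ◅◅ rp′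
        hub (there (there (here refl)))                 = pq′ ◅◅ qr′ , rp′
        hub (there (there (there (here refl))))         = ps′ , st′ ◅◅ tp′
        hub (there (there (there (there (here refl))))) = ps′ ◅◅ st′ , tp′

      -- Two triangles on a common spine `qp`, with distinct pages `r` and `s`. Comparing a further
      -- triangle at `p` or `q` with both of them forces it to contain the spine too, as the other
      -- alternative of `share` would identify `r` with `s`.
      record Book : Set where
        field
          {p q r s} : Fin N
          r≢s : r ≢ s
          qp : q ⟶ p
          pr : p ⟶ r
          rq : r ⟶ q
          ps : p ⟶ s
          sq : s ⟶ q

        out-p : ∀ {w} → p ⟶ w → w ⟶ q
        out-p pw with t , wt , tp ← triangle pw
          with share pr rq qp pw wt tp | share ps sq qp pw wt tp
        ... | inj₂ refl | _         = wt
        ... | inj₁ _    | inj₂ refl = wt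
        ... | inj₁ r≡w  | inj₁ s≡w  = contradiction (trans r≡w (sym s≡w)) r≢s

        out-q : ∀ {w} → q ⟶ w → w ≡ p
        out-q qw with t , wt , tq ← triangle qw
          with share qp pr rq qw wt tq | share qp ps sq qw wt tq
        ... | inj₁ p≡w | _        = sym p≡w
        ... | inj₂ _   | inj₁ p≡w = sym p≡w
        ... | inj₂ r≡t | inj₂ s≡t = contradiction (trans r≡t (sym s≡t)) r≢s

        out-page : ∀ {x w} → p ⟶ x → x ⟶ q → x ⟶ w → w ≡ q
        out-page px xq xw with t , wt , tx ← triangle xw with share xq qp px xw wt tx
        ... | inj₁ q≡w  = sym q≡w
        -- The triangle on `xw` now closes at `p`, where it meets both given triangles.
        ... | inj₂ refl with share pr rq qp tx xw wt | share ps sq qp tx xw wt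
        ...   | inj₂ q≡w | _        = sym q≡w
        ...   | inj₁ _   | inj₂ q≡w = sym q≡w
        ...   | inj₁ r≡x | inj₁ s≡x = contradiction (trans r≡x (sym s≡x)) r≢s

        Placed : Fin N → Set
        Placed u = u ≡ p ⊎ u ≡ q ⊎ p ⟶ u × u ⟶ q

        -- `Placed` holds at `p` and is preserved along arcs, and every node is reachable from `p`.
        place : ∀ u → Placed u
        place u = follow (strong p u) (inj₁ refl)
          where
          follow : ∀ {u v} → Star _⟶_ u v → Placed u → Placed v
          follow ε placed = placed
          follow (a ◅ w) (inj₁ refl)             = follow w (inj₂ (inj₂ (a , out-p a)))
          follow (a ◅ w) (inj₂ (inj₁ refl))      = follow w (inj₁ (out-q a))
          follow (a ◅ w) (inj₂ (inj₂ (px , xq))) = follow w (inj₂ (inj₁ (out-page px xq a)))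

        classify : ∀ {u v} → u ⟶ v → (u ≡ q × v ≡ p) ⊎ (u ≡ p × v ⟶ q) ⊎ (v ≡ q × p ⟶ u)
        classify {u} a with place u
        ... | inj₁ refl             = inj₂ (inj₁ (refl , out-p a))
        ... | inj₂ (inj₁ refl)      = inj₁ (refl , out-q a)
        ... | inj₂ (inj₂ (pu , uq)) = inj₂ (inj₂ (out-page pu uq a , pu))

        ¬pq : ¬ p ⟶ q
        ¬pq pq = no-digon pq qp

        -- For the degrees in G: a single arc out of `u` leaves `A u` with that arc and its matching
        -- edge. By this and `in-unique`, only `A p` and `B q` can have other degrees.
        out-unique : ∀ {u v w} → u ≢ p → u ⟶ v → u ⟶ w → v ≡ w
        out-unique u≢p a b with classify a | classify b
        ... | inj₁ (_ , refl)        | inj₁ (_ , refl)        = refl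
        ... | inj₁ (refl , _)        | inj₂ (inj₂ (_ , pq))   = contradiction pq ¬pq
        ... | inj₂ (inj₂ (_ , pq))   | inj₁ (refl , _)        = contradiction pq ¬pq
        ... | inj₂ (inj₂ (refl , _)) | inj₂ (inj₂ (refl , _)) = refl
        ... | inj₂ (inj₁ (u≡p , _))  | _                      = contradiction u≡p u≢p
        ... | inj₁ _                 | inj₂ (inj₁ (u≡p , _))  = contradiction u≡p u≢p
        ... | inj₂ (inj₂ _)          | inj₂ (inj₁ (u≡p , _))  = contradiction u≡p u≢p

        in-unique : ∀ {u v w} → w ≢ q → u ⟶ w → v ⟶ w → u ≡ v
        in-unique w≢q a b with classify a | classify b
        ... | inj₁ (refl , _)        | inj₁ (refl , _)        = refl
        ... | inj₁ (_ , refl)        | inj₂ (inj₁ (_ , pq))   = contradiction pq ¬pq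
        ... | inj₂ (inj₁ (_ , pq))   | inj₁ (_ , refl)        = contradiction pq ¬pq
        ... | inj₂ (inj₁ (refl , _)) | inj₂ (inj₁ (refl , _)) = refl
        ... | inj₂ (inj₂ (w≡q , _))  | _                      = contradiction w≡q w≢q
        ... | inj₁ _                 | inj₂ (inj₂ (w≡q , _))  = contradiction w≡q w≢q
        ... | inj₂ (inj₁ _)          | inj₂ (inj₂ (w≡q , _))  = contradiction w≡q w≢q

        corners-Unique : Unique (p ∷ q ∷ r ∷ s ∷ [])
        corners-Unique =
            (apart qp ∘ sym ∷ apart pr ∷ apart ps ∷ [])
          ∷ (apart rq ∘ sym ∷ apart sq ∘ sym ∷ [])
          ∷ (r≢s ∷ []) ∷ [] ∷ []
          where
          apart : ∀ {u v} → u ⟶ v → u ≢ v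
          apart a refl = no-loop a

      -- What is kept of the triangle: it makes every vertex of G have degree two.
      Functional : Set
      Functional = (∀ {u v w} → u ⟶ v → u ⟶ w → v ≡ w) × (∀ {u v w} → u ⟶ w → v ⟶ w → u ≡ v)

      -- The triangle on the second arc out of `u` cannot share `uv`, so it shares `wu`, which
      -- becomes the spine.
      pages : ∀ {u v w x} → u ⟶ v → v ⟶ w → w ⟶ u → u ⟶ x → v ≢ x → Book
      pages uv vw wu ux v≢x with t , xt , tu ← triangle ux with share uv vw wu ux xt tu
      ... | inj₁ v≡x  = contradiction v≡x v≢x
      ... | inj₂ refl = record { r≢s = v≢x ; qp = wu ; pr = uv ; rq = vw ; ps = ux ; sq = xt }

      TriangleOn : Fin N → Fin N → Fin N → Set
      TriangleOn a b c = a ⟶ b × b ⟶ c × c ⟶ a × (∀ z → z ∈ a ∷ b ∷ c ∷ [])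

      rotate : ∀ {a b c} → TriangleOn a b c → TriangleOn b c a
      rotate {a} {b} {c} (ab , bc , ca , all∈) = bc , ca , ab , λ z → turn (all∈ z)
        where
        turn : ∀ {z} → z ∈ a ∷ b ∷ c ∷ [] → z ∈ b ∷ c ∷ a ∷ []
        turn (here z≡)                 = there (there (here z≡))
        turn (there (here z≡))         = here z≡
        turn (there (there (here z≡))) = there (here z≡)

      triangle-out : ∀ {a b c} → TriangleOn a b c → ∀ {z} → a ⟶ z → z ≡ b
      triangle-out (ab , bc , ca , all∈) {z} az with all∈ z
      ... | here refl                 = contradiction az no-loop
      ... | there (here z≡b)          = z≡b
      ... | there (there (here refl)) = contradiction ca (no-digon az)

      triangle-in : ∀ {a b c} → TriangleOn a b c → ∀ {z} → z ⟶ a → z ≡ c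
      triangle-in (ab , bc , ca , all∈) {z} za with all∈ z
      ... | here refl                = contradiction za no-loop
      ... | there (here refl)        = contradiction za (no-digon ab)
      ... | there (there (here z≡c)) = z≡c

      triangle-Functional : ∀ {a b c} → TriangleOn a b c → Functional
      triangle-Functional {a} {b} {c} abc@(_ , _ , _ , all∈) = out , into
        where
        bca = rotate abc
        cab = rotate bca
        out : ∀ {u v w} → u ⟶ v → u ⟶ w → v ≡ w
        out {u} uv uw with all∈ u
        ... | here refl                 = trans (triangle-out abc uv) (sym (triangle-out abc uw))
        ... | there (here refl)         = trans (triangle-out bca uv) (sym (triangle-out bca uw))
        ... | there (there (here refl)) = trans (triangle-out cab uv) (sym (triangle-out cab uw))
        into : ∀ {u v w} → u ⟶ w → v ⟶ w → u ≡ v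
        into {w = w} uw vw with all∈ w
        ... | here refl                 = trans (triangle-in abc uw) (sym (triangle-in abc vw))
        ... | there (here refl)         = trans (triangle-in bca uw) (sym (triangle-in bca vw))
        ... | there (there (here refl)) = trans (triangle-in cab uw) (sym (triangle-in cab vw))

      -- Either the triangle on an arc out of `x` contains every node, or strong connectivity yields
      -- an arc that leaves it, and `pages` applies at the tail of that arc.
      structure : ∀ {x y : Fin N} → x ≢ y → Functional ⊎ Book
      structure {x} {y} x≢y with strong x y
      ... | ε = contradiction refl x≢y
      ... | _◅_ {j = v} xv _ with w , vw , wx ← triangle xv
        with any? (λ z → ¬? (z ∈? x ∷ v ∷ w ∷ []))
        where open import Data.List.Membership.DecPropositional (_≟_ {N}) using (_∈?_)
      ...   | yes (z , z∉) = inj₂ (leave (Growth.exit src tgt strong (strong x z) (here refl) z∉))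
        where
        leave : (∃[ f ] src f ∈ x ∷ v ∷ w ∷ [] × tgt f ∉ x ∷ v ∷ w ∷ []) → Book
        leave (f , here s≡ , t∉) =
          pages xv vw wx (f , s≡ , refl) λ { refl → t∉ (there (here refl)) }
        leave (f , there (here s≡) , t∉) =
          pages vw wx xv (f , s≡ , refl) λ { refl → t∉ (there (there (here refl))) }
        leave (f , there (there (here s≡)) , t∉) =
          pages wx xv vw (f , s≡ , refl) λ { refl → t∉ (here refl) }
      ...   | no none = inj₁ (triangle-Functional (xv , vw , wx , λ z →
        decidable-stable (z ∈? x ∷ v ∷ w ∷ []) λ z∉ → none (z , z∉)))
        where open import Data.List.Membership.DecPropositional (_≟_ {N}) using (_∈?_)

-- Permutations and subsets

transpose-left : ∀ {n} (i j : Fin n) → transpose i j i ≡ j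
transpose-left i j with i ≟ i
... | yes _  = refl
... | no i≢i = contradiction refl i≢i

transpose-right : ∀ {n} (i j : Fin n) → transpose i j j ≡ i
transpose-right i j with j ≟ i
... | yes j≡i = j≡i
... | no _ with j ≟ j
...   | yes _  = refl
...   | no j≢j = contradiction refl j≢j

transpose-fixed : ∀ {n} {i j k : Fin n} → k ≢ i → k ≢ j → transpose i j k ≡ k
transpose-fixed {i = i} {j} {k} k≢i k≢j with k ≟ i
... | yes k≡i = contradiction k≡i k≢i
... | no _ with k ≟ j
...   | yes k≡j = contradiction k≡j k≢j
...   | no _    = refl

-- Two iterates coincide by the pigeonhole principle, and injectivity cancels their common initial
-- steps until one of them is `x` itself.
orbit-returns : ∀ {n} (σ : Fin n → Fin n) → (∀ {x y} → σ x ≡ σ y → x ≡ y) →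
                ∀ x → Star (λ y z → σ y ≡ z) (σ x) x
orbit-returns {n} σ σ-injective x
  with i , j , i<j , eq ← pigeonhole (n<1+n n) (fold x σ ∘ toℕ) = cancel (toℕ i) (toℕ j) i<j eq
  where
  forward : ∀ d → Star (λ y z → σ y ≡ z) (σ x) (fold x σ (suc d))
  forward zero    = ε
  forward (suc d) = forward d ◅◅ refl ◅ ε
  cancel : ∀ i j → i < j → fold x σ i ≡ fold x σ j → Star (λ y z → σ y ≡ z) (σ x) x
  cancel zero    (suc j) _         eq = subst (Star _ _) (sym eq) (forward j)
  cancel (suc i) (suc j) (s≤s i<j) eq = cancel i j i<j (σ-injective eq)

module _ {n} {P : Fin n → Set} (P? : Decidable P) where

  subset : Subset n
  subset = Vec.tabulate (does ∘ P?)

  ∈-subset⁺ : ∀ {x} → P x → x Subset.∈ subset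
  ∈-subset⁺ {x} px = lookup⇒[]= x _ (trans (lookup∘tabulate _ x) (dec-true (P? x) px))

  ∈-subset⁻ : ∀ {x} → x Subset.∈ subset → P x
  ∈-subset⁻ {x} x∈ with P? x | trans (sym (lookup∘tabulate (does ∘ P?) x)) ([]=⇒lookup x∈)
  ... | yes px | _  = px
  ... | no _   | ()

-- Bipartite graphs with a perfect matching

-- Contracting the matching edges A x — B x leaves a digraph on the indices x,
-- in which every edge e runs from src e to tgt e; matching edges become loops.
record Frame (G : Graph) : Set where
  open Graph G
  field
    {nodes}     : ℕ
    A B         : Fin nodes → Vertex
    A-injective : ∀ {x y} → A x ≡ A y → x ≡ y
    B-injective : ∀ {x y} → B x ≡ B y → x ≡ y
    A≢B         : ∀ {x y} → A x ≢ B y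
    cover       : ∀ v → (∃[ x ] A x ≡ v) ⊎ (∃[ x ] B x ≡ v)
    src tgt     : Edge → Fin nodes
    joins       : ∀ e → Joins e (A (src e)) (B (tgt e))
    mate        : Fin nodes → Edge
    src-mate    : ∀ x → src (mate x) ≡ x
    tgt-mate    : ∀ x → tgt (mate x) ≡ x

  open Digraph src tgt public

  incident-A : ∀ e → Incident (A (src e)) e
  incident-A e with joins e
  ... | inj₁ eq = inj₁ (cong proj₁ eq)
  ... | inj₂ eq = inj₂ (cong proj₂ eq)

  incident-B : ∀ e → Incident (B (tgt e)) e
  incident-B e with joins e
  ... | inj₁ eq = inj₂ (cong proj₂ eq)
  ... | inj₂ eq = inj₁ (cong proj₁ eq)

  joins-ends : ∀ {e u v} → Joins e u v →
               (u ≡ A (src e) × v ≡ B (tgt e)) ⊎ (u ≡ B (tgt e) × v ≡ A (src e))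
  joins-ends {e} e∈uv with joins e | e∈uv
  ... | inj₁ eq | inj₁ refl = inj₁ (cong proj₁ eq , cong proj₂ eq)
  ... | inj₁ eq | inj₂ refl = inj₂ (cong proj₂ eq , cong proj₁ eq)
  ... | inj₂ eq | inj₁ refl = inj₂ (cong proj₁ eq , cong proj₂ eq)
  ... | inj₂ eq | inj₂ refl = inj₁ (cong proj₂ eq , cong proj₁ eq)

  ends-of : ∀ {v e} → Incident v e → v ≡ A (src e) ⊎ v ≡ B (tgt e)
  ends-of v∈e with joins-ends (inj₁ refl) | v∈e
  ... | inj₁ (p , _) | inj₁ refl = inj₁ p
  ... | inj₁ (_ , q) | inj₂ refl = inj₂ q
  ... | inj₂ (p , _) | inj₁ refl = inj₂ p
  ... | inj₂ (_ , q) | inj₂ refl = inj₁ q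

  incident-A⇒src : ∀ {x e} → Incident (A x) e → x ≡ src e
  incident-A⇒src x∈e with ends-of x∈e
  ... | inj₁ eq = A-injective eq
  ... | inj₂ eq = contradiction eq A≢B

  incident-B⇒tgt : ∀ {y e} → Incident (B y) e → y ≡ tgt e
  incident-B⇒tgt y∈e with ends-of y∈e
  ... | inj₁ eq = contradiction (sym eq) A≢B
  ... | inj₂ eq = B-injective eq

  joins-sym : ∀ {e u v} → Joins e u v → Joins e v u
  joins-sym (inj₁ eq) = inj₂ eq
  joins-sym (inj₂ eq) = inj₁ eq

  mate-joins : ∀ x → Joins (mate x) (A x) (B x)
  mate-joins x =
    subst₂ (λ a b → Joins (mate x) (A a) (B b)) (src-mate x) (tgt-mate x) (joins (mate x))

  node : Vertex → Fin nodes
  node u with cover u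
  ... | inj₁ (x , _) = x
  ... | inj₂ (x , _) = x

  node-A : ∀ x → node (A x) ≡ x
  node-A x with cover (A x)
  ... | inj₁ (_ , eq) = A-injective eq
  ... | inj₂ (_ , eq) = contradiction (sym eq) A≢B

  node-B : ∀ x → node (B x) ≡ x
  node-B x with cover (B x)
  ... | inj₁ (_ , eq) = contradiction eq A≢B
  ... | inj₂ (_ , eq) = B-injective eq

  -- An arc from `x` to `y` is the path `A x`, `B y`, `A y` of G, whose second edge is a matching
  -- edge.
  strong⇒connected : StronglyConnected → Connected
  strong⇒connected strong u v = toA u ◅◅ along (strong _ _) ◅◅ fromA v
    where
    adjacent-sym : ∀ {u v} → Adjacent u v → Adjacent v u
    adjacent-sym (e , j) = e , joins-sym j
    toA : ∀ u → Star Adjacent u (A (node u))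
    toA u with cover u
    ... | inj₁ (x , refl) = ε
    ... | inj₂ (x , refl) = (mate x , joins-sym (mate-joins x)) ◅ ε
    fromA : ∀ u → Star Adjacent (A (node u)) u
    fromA u = Star.reverse adjacent-sym (toA u)
    along : ∀ {x y} → Star _⟶_ x y → Star Adjacent (A x) (A y)
    along ε = ε
    along ((e , refl , refl) ◅ w) =
      (e , joins e) ◅ (mate (tgt e) , joins-sym (mate-joins (tgt e))) ◅ along w

  -- Moves each node of a path from `u` to `v` one step forward and its end `v` back to `u`. That
  -- last move is left to the edge which is to enter the matching; nodes off the path keep their
  -- matching edges.
  record Rotation (u v : Fin nodes) (xs : List (Fin nodes)) : Set where
    field
      perm  : Permutation′ nodes
      start : perm ⟨$⟩ʳ v ≡ u
      fixed : ∀ {x} → x ∉ xs → perm ⟨$⟩ʳ x ≡ x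
      moved : ∀ {x} → x ≢ v → x ⟶ perm ⟨$⟩ʳ x

  -- The rotation of the tail of the path fixes `u` and sends `v` to `w`; following it by the
  -- transposition of `u` and `w` sends `u` to `w` and `v` to `u`.
  rotation : ∀ {u v xs fs} → SimplePath v u xs fs → Rotation u v xs
  rotation stop = record
    { perm = Perm.id ; start = refl ; fixed = λ _ → refl
    ; moved = λ {x} _ → mate x , src-mate x , tgt-mate x }
  rotation {v = v} (step {u = u} {w} {xs} uw p u∉xs) = record
    { perm  = σ ∘ₚ Perm.transpose u w
    ; start = trans (cong (transpose u w) start) (transpose-right u w)
    ; fixed = λ x∉ → trans (cong (transpose u w) (fixed (x∉ ∘ there)))
        (transpose-fixed (x∉ ∘ here) λ { refl → x∉ (there (path-start p)) })
    ; moved = λ {x} x≢v → moved′ x x≢v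
    }
    where
    open Rotation (rotation p) renaming (perm to σ)
    σ-injective : ∀ {x y} → σ ⟨$⟩ʳ x ≡ σ ⟨$⟩ʳ y → x ≡ y
    σ-injective eq = trans (sym (Perm.inverseˡ σ)) (trans (cong (σ ⟨$⟩ˡ_) eq) (Perm.inverseˡ σ))
    moved′ : ∀ x → x ≢ v → x ⟶ transpose u w (σ ⟨$⟩ʳ x)
    moved′ x x≢v with x ≟ u
    ... | yes refl = subst (x ⟶_)
      (sym (trans (cong (transpose u w) (fixed u∉xs)) (transpose-left u w))) uw
    ... | no x≢u = subst (x ⟶_) (sym (transpose-fixed
      (λ eq → x≢u (σ-injective (trans eq (sym (fixed u∉xs)))))
      (λ eq → x≢v (σ-injective (trans eq (sym start)))))) (moved x≢v)

  -- The edge `μ x` covers `A x` and `B (σ x)`, so bijectivity of `σ` gives each vertex one edge.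
  -- The image of `μ` is written as a decidable condition on `e`.
  permutation⇒matching : (μ : Fin nodes → Edge) (σ : Permutation′ nodes) →
    (∀ x → src (μ x) ≡ x) → (∀ x → tgt (μ x) ≡ σ ⟨$⟩ʳ x) →
    PerfectMatching (subset λ e → μ (src e) ≟ e)
  permutation⇒matching μ σ src-μ tgt-μ v with cover v
  ... | inj₁ (x , refl) = μ x
    , (∈-subset⁺ (λ e → μ (src e) ≟ e) (cong μ (src-μ x))
      , subst (λ z → Incident (A z) (μ x)) (src-μ x) (incident-A (μ x)))
    , λ (e∈ , x∈e) → trans (cong μ (incident-A⇒src x∈e)) (∈-subset⁻ (λ e → μ (src e) ≟ e) e∈)
  ... | inj₂ (y , refl) = μ x
    , (∈-subset⁺ (λ e → μ (src e) ≟ e) (cong μ (src-μ x))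
      , subst (λ z → Incident (B z) (μ x)) (trans (tgt-μ x) (Perm.inverseʳ σ)) (incident-B (μ x)))
    , λ {e} (e∈ , y∈e) →
        let μe≡e = ∈-subset⁻ (λ e → μ (src e) ≟ e) e∈
        in trans (cong (μ ∘ (σ ⟨$⟩ˡ_))
             (trans (incident-B⇒tgt y∈e) (trans (cong tgt (sym μe≡e)) (tgt-μ (src e)))))
             (trans (cong μ (Perm.inverseˡ σ)) μe≡e)
    where
    x = σ ⟨$⟩ˡ y

  -- A path from `tgt e` to `src e` closes with `e` to a directed cycle, possibly a loop; exchanging
  -- along the corresponding alternating cycle of G brings `e` into the matching.
  strong⇒matched : StronglyConnected → ∀ e → ∃[ M ] PerfectMatching M × e Subset.∈ M
  strong⇒matched strong e with xs , _ , p ← simplify (strong (tgt e) (src e)) =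
    _ , permutation⇒matching (proj₁ ∘ choice) σ (proj₁ ∘ proj₂ ∘ choice) (proj₂ ∘ proj₂ ∘ choice)
      , ∈-subset⁺ (λ f → proj₁ (choice (src f)) ≟ f) e∈
    where
    open Rotation (rotation p) renaming (perm to σ)
    choice : ∀ x → x ⟶ σ ⟨$⟩ʳ x
    choice x with x ≟ src e
    ... | yes refl = e , refl , sym start
    ... | no x≢    = moved x≢
    e∈ : proj₁ (choice (src e)) ≡ e
    e∈ with src e ≟ src e
    ... | yes refl = refl
    ... | no ≢    = contradiction refl ≢

  strong⇒covered : 4 ≤ order → StronglyConnected → MatchingCovered
  strong⇒covered 4≤n strong = strong⇒connected strong , 4≤n , strong⇒matched strong

  -- A walk in G may traverse an edge against its arc, from the `B` end to the `A` end; `back`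
  -- replaces such a step by a directed walk.
  covered⇒strong : MatchingCovered → StronglyConnected
  covered⇒strong (connected , _ , matched) x y =
    subst₂ (Star _⟶_) (node-A x) (node-A y) (along (connected (A x) (A y)))
    where
    -- A second perfect matching through e acts on the nodes as a permutation moving
    -- src e to tgt e, whose orbit leads back.
    back : ∀ e → Star _⟶_ (tgt e) (src e)
    back e with M , perfect , e∈M ← matched e = subst (λ z → Star _⟶_ z (src e)) σ-src
      (Star.map (λ {x} σx≡y → m x , src-m x , σx≡y) (orbit-returns σ σ-injective (src e)))
      where
      m : Fin nodes → Edge
      m x = proj₁ (perfect (A x))
      σ : Fin nodes → Fin nodes
      σ x = tgt (m x)
      src-m : ∀ x → src (m x) ≡ x
      src-m x = sym (incident-A⇒src (proj₂ (proj₁ (proj₂ (perfect (A x))))))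
      m-unique : ∀ {f} → f Subset.∈ M → m (src f) ≡ f
      m-unique {f} f∈ = proj₂ (proj₂ (perfect (A (src f)))) (f∈ , incident-A f)
      σ-src : σ (src e) ≡ tgt e
      σ-src = cong tgt (m-unique e∈M)
      σ-injective : ∀ {x y} → σ x ≡ σ y → x ≡ y
      σ-injective {x} {y} eq = trans (sym (src-m x)) (trans (cong src m≡) (src-m y))
        where
        unique = proj₂ (proj₂ (perfect (B (σ y))))
        in-M : ∀ x → m x Subset.∈ M
        in-M x = proj₁ (proj₁ (proj₂ (perfect (A x))))
        m≡ : m x ≡ m y
        m≡ = trans
          (sym (unique (in-M x , subst (λ z → Incident (B z) (m x)) eq (incident-B (m x)))))
          (unique (in-M y , incident-B (m y)))

    both : ∀ {e u v} → Joins e u v → Star _⟶_ (node u) (node v)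
    both {e} e∈uv with joins-ends e∈uv
    ... | inj₁ (refl , refl) = subst₂ (Star _⟶_) (sym (node-A _)) (sym (node-B _))
      ((e , refl , refl) ◅ ε)
    ... | inj₂ (refl , refl) = subst₂ (Star _⟶_) (sym (node-B _)) (sym (node-A _)) (back e)

    along : ∀ {u v} → Star Adjacent u v → Star _⟶_ (node u) (node v)
    along ε             = ε
    along ((e , j) ◅ w) = both j ◅◅ along w

-- The matching avoids `e`, so the same frame serves for the graph without `e`, and every use of `e`
-- in a directed walk is replaced by the detour.
detour⇒removable : ∀ (G : Graph) (F : Frame G) → let open Graph G; open Frame F in
  4 ≤ order → StronglyConnected → ∀ e → (∀ x → mate x ≢ e) →
  Star (Avoiding e) (src e) (tgt e) → Graph.MatchingCovered (G -ₑ e)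
detour⇒removable record { size = zero } _ _ _ ()
detour⇒removable G@record { size = suc _ } F 4≤n strong e unmated detour =
  Frame.strong⇒covered F′ 4≤n λ x y → strong x y Star.>>= replace
  where
  open Frame F
  F′ : Frame (G -ₑ e)
  F′ = record
    { A = A ; B = B ; A-injective = A-injective ; B-injective = B-injective ; A≢B = A≢B
    ; cover = cover ; src = src ∘ punchIn e ; tgt = tgt ∘ punchIn e ; joins = joins ∘ punchIn e
    ; mate = λ x → punchOut (unmated x ∘ sym)
    ; src-mate = λ x → trans (cong src (punchIn-punchOut _)) (src-mate x)
    ; tgt-mate = λ x → trans (cong tgt (punchIn-punchOut _)) (tgt-mate x)
    }
  keep : ∀ {x y} → Avoiding e x y → Frame._⟶_ F′ x y
  keep (f , f≢e , s , t) = punchOut (f≢e ∘ sym)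
    , trans (cong src (punchIn-punchOut _)) s , trans (cong tgt (punchIn-punchOut _)) t
  replace : ∀ {x y} → x ⟶ y → Star (Frame._⟶_ F′) x y
  replace (f , refl , refl) with f ≟ e
  ... | yes refl = Star.map keep detour
  ... | no f≢e   = keep (f , f≢e , refl , refl) ◅ ε

module _ (G : Graph) where

  open Graph G

  -- The nodes are the positions in the list of matching edges; `A` and `B` pick the end coloured
  -- `true` and the end coloured `false`.
  bipartite⇒frame : Bipartite → ∃[ M ] PerfectMatching M → Frame G
  bipartite⇒frame (colour , proper) (M , perfect) = record
    { A = blackEnd ∘ mate ; B = whiteEnd ∘ mate
    ; A-injective = λ {x} {y} eq → lookup-injective mates-Unique
        (m-unique (∈M x) (∈M y) (black-incident (mate x))
          (subst (λ v → Incident v (mate y)) (sym eq) (black-incident (mate y))))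
    ; B-injective = λ {x} {y} eq → lookup-injective mates-Unique
        (m-unique (∈M x) (∈M y) (white-incident (mate x))
          (subst (λ v → Incident v (mate y)) (sym eq) (white-incident (mate y))))
    ; A≢B = λ {x} {y} eq →
        true≢false (trans (sym (black (mate x))) (trans (cong colour eq) (white (mate y))))
    ; cover = cover
    ; src = position ∘ blackEnd ; tgt = position ∘ whiteEnd
    ; joins = λ e → subst₂ (Joins e)
        (sym (A-position (black e))) (sym (B-position (white e))) (orient-joins e)
    ; mate = mate
    ; src-mate = λ x → position-unique x (black-incident (mate x))
    ; tgt-mate = λ x → position-unique x (white-incident (mate x))
    }
    where
    true≢false : true ≢ false
    true≢false ()

    orient : ∀ e → ∃[ a ] ∃[ b ] colour a ≡ true × colour b ≡ false × Joins e a b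
    orient e with colour (proj₁ (ends e)) in p | colour (proj₂ (ends e)) in q
    ... | true  | false = _ , _ , p , q , inj₁ refl
    ... | false | true  = _ , _ , q , p , inj₂ refl
    ... | true  | true  = contradiction (trans p (sym q)) (proper e)
    ... | false | false = contradiction (trans p (sym q)) (proper e)

    blackEnd whiteEnd : Edge → Vertex
    blackEnd e = proj₁ (orient e)
    whiteEnd e = proj₁ (proj₂ (orient e))
    black : ∀ e → colour (blackEnd e) ≡ true
    black e = proj₁ (proj₂ (proj₂ (orient e)))
    white : ∀ e → colour (whiteEnd e) ≡ false
    white e = proj₁ (proj₂ (proj₂ (proj₂ (orient e))))
    orient-joins : ∀ e → Joins e (blackEnd e) (whiteEnd e)
    orient-joins e = proj₂ (proj₂ (proj₂ (proj₂ (orient e))))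

    black-incident : ∀ e → Incident (blackEnd e) e
    black-incident e with orient-joins e
    ... | inj₁ eq = inj₁ (cong proj₁ eq)
    ... | inj₂ eq = inj₂ (cong proj₂ eq)
    white-incident : ∀ e → Incident (whiteEnd e) e
    white-incident e with orient-joins e
    ... | inj₁ eq = inj₂ (cong proj₂ eq)
    ... | inj₂ eq = inj₁ (cong proj₁ eq)

    end-cases : ∀ {v e} → Incident v e → v ≡ blackEnd e ⊎ v ≡ whiteEnd e
    end-cases {e = e} v∈e with orient-joins e | v∈e
    ... | inj₁ eq | inj₁ refl = inj₁ (cong proj₁ eq)
    ... | inj₁ eq | inj₂ refl = inj₂ (cong proj₂ eq)
    ... | inj₂ eq | inj₁ refl = inj₂ (cong proj₁ eq)
    ... | inj₂ eq | inj₂ refl = inj₁ (cong proj₂ eq)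

    mates : List Edge
    mates = filter (_∈ˢ? M) (allFin size)
    mates-Unique : Unique mates
    mates-Unique = filter⁺ (_∈ˢ? M) (allFin⁺ size)
    mate : Fin (length mates) → Edge
    mate = lookup mates
    ∈M : ∀ x → mate x Subset.∈ M
    ∈M x = proj₂ (∈-filter⁻ (_∈ˢ? M) {xs = allFin size} (∈-lookup x))

    m : Vertex → Edge
    m v = proj₁ (perfect v)
    m-incident : ∀ v → Incident v (m v)
    m-incident v = proj₂ (proj₁ (proj₂ (perfect v)))
    m-unique : ∀ {v e f} → e Subset.∈ M → f Subset.∈ M → Incident v e → Incident v f → e ≡ f
    m-unique {v} e∈ f∈ v∈e v∈f =
      trans (sym (proj₂ (proj₂ (perfect v)) (e∈ , v∈e))) (proj₂ (proj₂ (perfect v)) (f∈ , v∈f))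
    m-listed : ∀ v → m v ∈ mates
    m-listed v = ∈-filter⁺ (_∈ˢ? M) (∈-allFin _) (proj₁ (proj₁ (proj₂ (perfect v))))
    position : Vertex → Fin (length mates)
    position v = index (m-listed v)
    mate-position : ∀ v → mate (position v) ≡ m v
    mate-position v = sym (lookup-index (m-listed v))
    position-incident : ∀ v → Incident v (mate (position v))
    position-incident v = subst (Incident v) (sym (mate-position v)) (m-incident v)
    position-unique : ∀ {v} x → Incident v (mate x) → position v ≡ x
    position-unique x v∈ = lookup-injective mates-Unique
      (m-unique (∈M _) (∈M x) (position-incident _) v∈)

    A-position : ∀ {v} → colour v ≡ true → blackEnd (mate (position v)) ≡ v
    A-position {v} v-black with end-cases (position-incident v)
    ... | inj₁ eq = sym eq
    ... | inj₂ eq = contradiction (trans (sym v-black) (trans (cong colour eq) (white _))) true≢false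
    B-position : ∀ {v} → colour v ≡ false → whiteEnd (mate (position v)) ≡ v
    B-position {v} v-white with end-cases (position-incident v)
    ... | inj₂ eq = sym eq
    ... | inj₁ eq =
      contradiction (trans (sym (black _)) (trans (cong colour (sym eq)) v-white)) true≢false
    cover : ∀ v → (∃[ x ] blackEnd (mate x) ≡ v) ⊎ (∃[ x ] whiteEnd (mate x) ≡ v)
    cover v with colour v in eq
    ... | true  = inj₁ (position v , A-position eq)
    ... | false = inj₂ (position v , B-position eq)

module _ {G : Graph} where

  open Graph G

  module _ (F : Frame G) where

    open Frame F

    -- The frame of the perfect matching obtained by switching along the 4-cycle
    -- A x, B y, A y, B x.
    switch : ∀ {x y} f g → src f ≡ x → tgt f ≡ y → src g ≡ y → tgt g ≡ x → Frame G
    switch {x} {y} f g sf tf sg tg = record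
      { A = A ; B = B ∘ transpose y x
      ; A-injective = A-injective
      ; B-injective = λ {u} {v} eq → trans (sym (transpose-inverse x y {u}))
          (trans (cong (transpose x y) (B-injective eq)) (transpose-inverse x y {v}))
      ; A≢B = A≢B
      ; cover = cover′
      ; src = src ; tgt = transpose x y ∘ tgt
      ; joins = λ e → subst (Joins e (A (src e))) (cong B (sym (transpose-inverse y x))) (joins e)
      ; mate = mate′
      ; src-mate = src-mate′
      ; tgt-mate = tgt-mate′
      }
      where
      cover′ : ∀ v → (∃[ u ] A u ≡ v) ⊎ (∃[ u ] B (transpose y x u) ≡ v)
      cover′ v with cover v
      ... | inj₁ covered   = inj₁ covered
      ... | inj₂ (u , Bu≡v) = inj₂ (transpose x y u , trans (cong B (transpose-inverse y x)) Bu≡v)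
      mate′ : Fin nodes → Edge
      mate′ z with z ≟ x | z ≟ y
      ... | yes _ | _     = f
      ... | no  _ | yes _ = g
      ... | no  _ | no  _ = mate z
      src-mate′ : ∀ z → src (mate′ z) ≡ z
      src-mate′ z with z ≟ x | z ≟ y
      ... | yes refl | _        = sf
      ... | no  _    | yes refl = sg
      ... | no  _    | no  _    = src-mate z
      tgt-mate′ : ∀ z → transpose x y (tgt (mate′ z)) ≡ z
      tgt-mate′ z with z ≟ x | z ≟ y
      ... | yes refl | _        = trans (cong (transpose x y) tf) (transpose-right x y)
      ... | no  _    | yes refl = trans (cong (transpose x y) tg) (transpose-left x y)
      ... | no  z≢x  | no  z≢y  = trans (cong (transpose x y) (tgt-mate z)) (transpose-fixed z≢x z≢y)

  module Reduction (minimal : Minimal G) (covered : MatchingCovered) where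

    -- Stated for every frame: an edge matched in one frame is tested in another frame where it is
    -- free.
    irredundant : (F : Frame G) → let open Frame F in
                  ∀ e → mate (src e) ≢ e → ¬ Star (Avoiding e) (src e) (tgt e)
    irredundant F e unmated detour = minimal e (detour⇒removable G F (proj₁ (proj₂ covered))
      (covered⇒strong covered) e
      (λ x eq → unmated (trans (cong mate (trans (cong src (sym eq)) (src-mate x))) eq)) detour)
      where open Frame F

    module _ (F : Frame G) where

      open Frame F

      module _ (x y : Fin nodes) where

        Outside : Fin nodes → Set
        Outside z = z ≢ x × z ≢ y

        Outer : Fin nodes → Fin nodes → Set
        Outer u v = ∃[ e ] Outside u × Outside v × src e ≡ u × tgt e ≡ v

        -- A walk with at least one inner node, all inner nodes lying off `x` and `y`. The case
        -- `u ≡ v` is allowed; it is the one that requires a switch.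
        record Ear (u v : Fin nodes) : Set where
          field
            first last     : Edge
            leaves         : src first ≡ u
            departs        : Outside (tgt first)
            middle         : Star Outer (tgt first) (src last)
            approaches     : Outside (src last)
            enters         : tgt last ≡ v

        -- No edge of an ear has both its ends in {x , y}.
        ear⇒avoiding : ∀ {u v e} → ¬ Outside (src e) → ¬ Outside (tgt e) → Ear u v →
                       Star (Avoiding e) u v
        ear⇒avoiding src∈ tgt∈ ear =
          (first , (λ { refl → tgt∈ departs }) , leaves , refl)
            ◅ Star.map (λ (f , out , _ , s , t) →
                 f , (λ { refl → src∈ (subst Outside (sym s) out) }) , s , t) middle
            ◅◅ (last , (λ { refl → src∈ approaches }) , refl , enters) ◅ ε
          where open Ear ear

        hit : ∀ {u} → Outside u → Star _⟶_ u x →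
              ∃[ e ] Star Outer u (src e) × Outside (src e) × (tgt e ≡ x ⊎ tgt e ≡ y)
        hit out ε = contradiction refl (proj₁ out)
        hit out ((e , refl , refl) ◅ w) with tgt e ≟ x | tgt e ≟ y
        ... | yes t≡x | _       = e , ε , out , inj₁ t≡x
        ... | no _    | yes t≡y = e , ε , out , inj₂ t≡y
        ... | no t≢x  | no t≢y  with f , mid , out′ , t ← hit (t≢x , t≢y) w =
          f , (e , out , (t≢x , t≢y) , refl , refl) ◅ mid , out′ , t

        outside∉ : ∀ {z} → Outside z → z ∉ x ∷ y ∷ []
        outside∉ out (here eq)         = proj₁ out eq
        outside∉ out (there (here eq)) = proj₂ out eq

        -- Some arc leaves the pair because `z` is reachable from `x`; the walk from the head of
        -- that arc to `x` is cut where it first enters the pair.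
        ear : StronglyConnected → ∀ {z} → Outside z →
              ∃[ u ] ∃[ v ] (u ≡ x ⊎ u ≡ y) × (v ≡ x ⊎ v ≡ y) × Ear u v
        ear strong {z} out
          with f , s∈ , t∉ ← Growth.exit src tgt strong {x ∷ y ∷ []}
                 (strong x z) (here refl) (outside∉ out)
          with t-out ← (λ eq → t∉ (here eq)) , (λ eq → t∉ (there (here eq)))
          with g , mid , out′ , t ← hit t-out (strong (tgt f) x)
          = src f , tgt g , inner′ s∈ , t , record
            { first = f ; last = g ; leaves = refl ; departs = t-out ; middle = mid
            ; approaches = out′ ; enters = refl }
          where
          inner′ : ∀ {s} → s ∈ x ∷ y ∷ [] → s ≡ x ⊎ s ≡ y
          inner′ (here s≡x)         = inj₁ s≡x
          inner′ (there (here s≡y)) = inj₂ s≡y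

      -- After switching along the digon an ear from x to x becomes one from x to y, a
      -- detour for the old matching edge at x.
      no-closed-ear : ∀ {x y f g} → src f ≡ x → tgt f ≡ y → src g ≡ y → tgt g ≡ x →
                      mate x ≢ f → ¬ Ear x y x x
      no-closed-ear {x} {y} {f} {g} sf tf sg tg mx≢f ear =
        irredundant F′ (mate x) unmated
          (subst₂ (Star (Frame.Avoiding F′ (mate x))) (sym (src-mate x))
            (sym (trans (cong (transpose x y) (tgt-mate x)) (transpose-left x y))) detour)
        where
        F′ = switch F f g sf tf sg tg
        open Ear ear
        unmated : Frame.mate F′ (src (mate x)) ≢ mate x
        unmated = subst (λ z → Frame.mate F′ z ≢ mate x) (sym (src-mate x)) at-x
          where
          at-x : Frame.mate F′ x ≢ mate x
          at-x with x ≟ x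
          ... | yes _  = mx≢f ∘ sym
          ... | no x≢x = contradiction refl x≢x
        step-out : ∀ {u v} e → src e ≡ u → tgt e ≡ v → Outside x y u ⊎ Outside x y v →
                   e ≢ mate x
        step-out e s t (inj₁ (u≢x , _)) refl = u≢x (trans (sym s) (src-mate x))
        step-out e s t (inj₂ (v≢x , _)) refl = v≢x (trans (sym t) (tgt-mate x))
        unmoved : ∀ {v} → Outside x y v → transpose x y v ≡ v
        unmoved (v≢x , v≢y) = transpose-fixed v≢x v≢y
        detour : Star (Frame.Avoiding F′ (mate x)) x y
        detour =
          (first , step-out first refl refl (inj₂ departs) , leaves , unmoved departs)
            ◅ Star.map (λ (e , u , v , s , t) →
                 e , step-out e s t (inj₁ u) , s , trans (cong (transpose x y) t) (unmoved v)) middle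
            ◅◅ (last , step-out last refl refl (inj₁ approaches) , refl
               , trans (cong (transpose x y) enters) (transpose-left x y)) ◅ ε

      -- The third node `z` provides an ear on the digon. If its ends differ it is a detour for `f`
      -- or for `g`; if they agree `no-closed-ear` applies, with the roles of the two nodes
      -- exchanged when the ear sits at `tgt f`.
      no-digon : ∀ {f g z} → mate (src f) ≢ f → mate (src g) ≢ g →
                 src f ≡ tgt g → tgt f ≡ src g → z ≢ src f → z ≢ tgt f → ⊥
      no-digon {f} {g} f-free g-free st ts z≢s z≢t
        with u , v , u∈ , v∈ , e ← ear (src f) (tgt f) (covered⇒strong covered) (z≢s , z≢t)
        with u∈ | v∈
      ... | inj₁ refl | inj₂ refl = irredundant F f f-free
        (ear⇒avoiding _ _ (λ o → proj₁ o refl) (λ o → proj₂ o refl) e)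
      ... | inj₂ refl | inj₁ refl = irredundant F g g-free
        (subst₂ (Star (Avoiding g)) ts st
          (ear⇒avoiding _ _ (λ o → proj₂ o (sym ts)) (λ o → proj₁ o (sym st)) e))
      ... | inj₁ refl | inj₁ refl = no-closed-ear refl refl (sym ts) (sym st) f-free e
      ... | inj₂ refl | inj₂ refl = no-closed-ear (sym ts) (sym st) refl refl
        (subst (λ z → mate z ≢ g) (sym ts) g-free) record
          { first = first ; last = last ; leaves = leaves ; departs = flip departs
          ; middle = Star.map (λ (e , u , v , st) → e , flip u , flip v , st) middle
          ; approaches = flip approaches ; enters = enters }
        where
        open Ear e
        flip : ∀ {z} → Outside (src f) (tgt f) z → Outside (tgt f) (src f) z
        flip (a , b) = b , a

-- Extremal graphs

injective⇒surjective : ∀ {m n} {f : Fin m → Fin n} → m ≡ n → (∀ {x y} → f x ≡ f y → x ≡ y) →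
                       ∀ y → ∃[ x ] f x ≡ y
injective⇒surjective {m} {f = f} m≡n f-injective y
  with x , _ , y≡fx ← ∈-map⁻ f (Unique∧length≡⇒complete (map⁺ f-injective (allFin⁺ m))
         (trans (length-map f (allFin m)) (trans (length-tabulate id) m≡n)) y) = x , sym y≡fx

surjective⇒↔ : ∀ {m n} (f : Fin m → Fin n) → n ≡ m → (∀ y → ∃[ x ] f x ≡ y) → Fin n ↔ Fin m
surjective⇒↔ f n≡m onto = mk↔ₛ′ g f g∘f (proj₂ ∘ onto)
  where
  g = proj₁ ∘ onto
  g-injective : ∀ {x y} → g x ≡ g y → x ≡ y
  g-injective {x} {y} eq = trans (sym (proj₂ (onto x))) (trans (cong f eq) (proj₂ (onto y)))
  g∘f : ∀ x → g (f x) ≡ x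
  g∘f x with y , refl ← injective⇒surjective n≡m g-injective x = cong g (proj₂ (onto y))

module _ {G : Graph} where

  open Graph G

  degree≡2 : ∀ {v e f} → e ≢ f → Incident v e → Incident v f →
             (∀ {g} → Incident v g → g ∈ e ∷ f ∷ []) → degree v ≡ 2
  degree≡2 {v} {e} {f} e≢f v∈e v∈f only = ≤-antisym
    (Unique-⊆⇒length≤ (filter⁺ (incident? v) (allFin⁺ size)) λ g∈ →
      only (proj₂ (∈-filter⁻ (incident? v) {xs = allFin size} g∈)))
    (Unique-⊆⇒length≤ ((e≢f ∷ []) ∷ [] ∷ []) λ where
      (here refl)         → ∈-filter⁺ (incident? v) (∈-allFin e) v∈e
      (there (here refl)) → ∈-filter⁺ (incident? v) (∈-allFin f) v∈f)

  ∈-V₂ : ∀ {v} → degree v ≡ 2 → v ∈ V₂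
  ∈-V₂ {v} = ∈-filter⁺ (λ v → degree v ℕ.≟ 2) (∈-allFin v)

module _ {N k} (src tgt : Fin k → Fin N) where

  open Digraph src tgt

  module _ (strong : StronglyConnected) (2≤N : 2 ≤ N) where

    out-arc : ∀ x → ∃[ f ] src f ≡ x
    out-arc x with y , y∉ ← length<⇒missing {xs = x ∷ []} 2≤N with strong x y
    ... | ε                  = contradiction (here refl) y∉
    ... | (f , s , _) ◅ _ = f , s

    in-arc : ∀ x → ∃[ f ] tgt f ≡ x
    in-arc x with y , y∉ ← length<⇒missing {xs = x ∷ []} 2≤N
      with Star.reverse {U = λ u v → v ⟶ u} id (strong y x)
    ... | ε                  = contradiction (here refl) y∉
    ... | (f , _ , t) ◅ _ = f , t

    nodes≤arcs : N ≤ k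
    nodes≤arcs = injective⇒≤ {f = proj₁ ∘ out-arc} λ {x} {y} eq →
      trans (sym (proj₂ (out-arc x))) (trans (cong src eq) (proj₂ (out-arc y)))

module _ {G : Graph} (F : Frame G) where

  open Graph G
  open Frame F

  order≡ : order ≡ nodes + nodes
  order≡ = trans (sym (complete⇒length≡ vertices-Unique complete))
    (trans (length-++ (map A (allFin nodes))) (cong₂ _+_ (count A) (count B)))
    where
    count : (f : Fin nodes → Vertex) → length (map f (allFin nodes)) ≡ nodes
    count f = trans (length-map f (allFin nodes)) (length-tabulate id)
    vertices-Unique : Unique (map A (allFin nodes) ++ map B (allFin nodes))
    vertices-Unique =
      ++⁺ (map⁺ A-injective (allFin⁺ nodes)) (map⁺ B-injective (allFin⁺ nodes)) disjoint
      where
      disjoint : ∀ {v} → ¬ (v ∈ map A (allFin nodes) × v ∈ map B (allFin nodes))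
      disjoint (v∈A , v∈B) with _ , _ , refl ← ∈-map⁻ A v∈A with _ , _ , eq ← ∈-map⁻ B v∈B = A≢B eq
    complete : ∀ v → v ∈ map A (allFin nodes) ++ map B (allFin nodes)
    complete v with cover v
    ... | inj₁ (x , refl) = ∈-++⁺ˡ (∈-map⁺ A (∈-allFin x))
    ... | inj₂ (x , refl) = ∈-++⁺ʳ (map A (allFin nodes)) (∈-map⁺ B (∈-allFin x))

  -- The arcs of D are the unmatched edges. An edge parallel to a matching edge is among them, as a
  -- loop, until `no-loop` excludes it. The enumeration is opaque and used only through the
  -- properties stated here.
  abstract

    private
      free? : ∀ e → Dec (mate (src e) ≢ e)
      free? e = ¬? (mate (src e) ≟ e)

      free : List Edge
      free = filter free? (allFin size)

      free-Unique : Unique free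
      free-Unique = filter⁺ free? (allFin⁺ size)

    arcs : ℕ
    arcs = length free

    arc : Fin arcs → Edge
    arc = lookup free

    arc-injective : ∀ {i j} → arc i ≡ arc j → i ≡ j
    arc-injective = lookup-injective free-Unique

    arc-free : ∀ i → mate (src (arc i)) ≢ arc i
    arc-free i = proj₂ (∈-filter⁻ free? {xs = allFin size} (∈-lookup {xs = free} i))

    mate⊎arc : ∀ e → mate (src e) ≡ e ⊎ (∃[ i ] arc i ≡ e)
    mate⊎arc e with mate (src e) ≟ e
    ... | yes eq = inj₁ eq
    ... | no neq = inj₂ (index e∈ , sym (lookup-index e∈))
      where
      e∈ : e ∈ free
      e∈ = ∈-filter⁺ free? (∈-allFin e) neq

    size≡ : size ≡ nodes + arcs
    size≡ = trans (sym (complete⇒length≡ edges-Unique complete))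
      (trans (length-++ (map mate (allFin nodes)))
        (cong (_+ length free) (trans (length-map mate (allFin nodes)) (length-tabulate id))))
      where
      mate-injective : ∀ {x y} → mate x ≡ mate y → x ≡ y
      mate-injective {x} {y} eq = trans (sym (src-mate x)) (trans (cong src eq) (src-mate y))
      edges-Unique : Unique (map mate (allFin nodes) ++ free)
      edges-Unique = ++⁺ (map⁺ mate-injective (allFin⁺ nodes)) free-Unique disjoint
        where
        disjoint : ∀ {e} → ¬ (e ∈ map mate (allFin nodes) × e ∈ free)
        disjoint (e∈ , e-free) with x , _ , refl ← ∈-map⁻ mate e∈ =
          proj₂ (∈-filter⁻ free? {xs = allFin size} e-free) (cong mate (src-mate x))
      complete : ∀ e → e ∈ map mate (allFin nodes) ++ free
      complete e with mate (src e) ≟ e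
      ... | yes eq = ∈-++⁺ˡ (subst (_∈ map mate (allFin nodes)) eq (∈-map⁺ mate (∈-allFin (src e))))
      ... | no neq = ∈-++⁺ʳ (map mate (allFin nodes)) (∈-filter⁺ free? (∈-allFin e) neq)

  module Arcs = Digraph (src ∘ arc) (tgt ∘ arc)

  -- Matching edges are loops of the frame and are dropped from directed walks.
  arcs-strong : StronglyConnected → Arcs.StronglyConnected
  arcs-strong strong x y = strong x y Star.>>= shorten
    where
    shorten : ∀ {x y} → x ⟶ y → Star Arcs._⟶_ x y
    shorten (e , refl , refl) with mate⊎arc e
    ... | inj₂ (i , refl) = (i , refl , refl) ◅ ε
    ... | inj₁ eq         = subst (Star _ (src e))
      (trans (sym (tgt-mate (src e))) (cong tgt eq)) ε

  degree-A : ∀ i → (∀ j → src (arc j) ≡ src (arc i) → j ≡ i) → degree (A (src (arc i))) ≡ 2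
  degree-A i unique = degree≡2 {G = G} (arc-free i)
    (subst (λ x → Incident (A x) (mate (src (arc i)))) (src-mate _) (incident-A _))
    (incident-A _) only
    where
    only : ∀ {g} → Incident (A (src (arc i))) g → g ∈ mate (src (arc i)) ∷ arc i ∷ []
    only {g} inc with mate⊎arc g
    ... | inj₁ eq         = here (trans (sym eq) (cong mate (sym (incident-A⇒src inc))))
    ... | inj₂ (j , refl) = there (here (cong arc (unique j (sym (incident-A⇒src inc)))))

  degree-B : ∀ i → (∀ j → tgt (arc j) ≡ tgt (arc i) → j ≡ i) → degree (B (tgt (arc i))) ≡ 2
  degree-B i unique = degree≡2 {G = G} mate≢arc
    (subst (λ x → Incident (B x) (mate (tgt (arc i)))) (tgt-mate _) (incident-B _))
    (incident-B _) only
    where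
    mate≢arc : mate (tgt (arc i)) ≢ arc i
    mate≢arc eq = arc-free i (trans (cong mate (trans (cong src (sym eq)) (src-mate _))) eq)
    only : ∀ {g} → Incident (B (tgt (arc i))) g → g ∈ mate (tgt (arc i)) ∷ arc i ∷ []
    only {g} inc with mate⊎arc g
    ... | inj₁ eq         = here (trans (sym eq) (cong mate (sym (trans (incident-B⇒tgt inc)
                              (trans (cong tgt (sym eq)) (tgt-mate _))))))
    ... | inj₂ (j , refl) = there (here (cong arc (unique j (sym (incident-B⇒tgt inc)))))

module _ {G H : Graph} where

  private
    module G = Graph G
    module H = Graph H

  -- As the counts agree, it suffices to cover all vertices and edges of `G`. The maps start from
  -- `H` so that `G` can be listed in the numbering of `H`.
  surjections⇒≅ : (φ : H.Vertex → G.Vertex) (ψ : H.Edge → G.Edge) →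
    G.order ≡ H.order → G.size ≡ H.size →
    (∀ v → ∃[ w ] φ w ≡ v) → (∀ e → ∃[ f ] ψ f ≡ e) →
    (∀ f → G.Joins (ψ f) (φ (proj₁ (H.ends f))) (φ (proj₂ (H.ends f)))) → G ≅ H
  surjections⇒≅ φ ψ order≡ size≡ φ-onto ψ-onto ψ-joins = record
    { vertices = V ; edges = E ; joins = λ {e} → joins e }
    where
    V = surjective⇒↔ φ order≡ φ-onto
    E = surjective⇒↔ ψ size≡ ψ-onto
    toφ : ∀ {w} → Inverse.to V (φ w) ≡ w
    toφ = Inverse.inverseˡ V refl
    joins : ∀ e {u v} → G.Joins e u v → H.Joins (Inverse.to E e) (Inverse.to V u) (Inverse.to V v)
    joins e {u} {v} e∈uv =
      compare (subst (λ e → G.Joins e u v) (sym (proj₂ (ψ-onto e))) e∈uv) (ψ-joins f)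
      where
      f = Inverse.to E e
      compare : G.Joins (ψ f) u v → G.Joins (ψ f) (φ (proj₁ (H.ends f))) (φ (proj₂ (H.ends f))) →
                H.Joins f (Inverse.to V u) (Inverse.to V v)
      compare (inj₁ p) (inj₁ q) with refl ← trans (sym p) q = inj₁ (cong₂ _,_ (sym toφ) (sym toφ))
      compare (inj₁ p) (inj₂ q) with refl ← trans (sym p) q = inj₂ (cong₂ _,_ (sym toφ) (sym toφ))
      compare (inj₂ p) (inj₁ q) with refl ← trans (sym p) q = inj₂ (cong₂ _,_ (sym toφ) (sym toφ))
      compare (inj₂ p) (inj₂ q) with refl ← trans (sym p) q = inj₁ (cong₂ _,_ (sym toφ) (sym toφ))

module Layout {G : Graph} (F : Frame G) (order≡8 : Graph.order G ≡ 8) (size≡9 : Graph.size G ≡ 9)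
              {p q r s : Fin (Frame.nodes F)} (corner : ∀ x → x ∈ p ∷ q ∷ r ∷ s ∷ [])
              (qp : Arcs._⟶_ F q p) (pr : Arcs._⟶_ F p r) (rq : Arcs._⟶_ F r q)
              (ps : Arcs._⟶_ F p s) (sq : Arcs._⟶_ F s q)
              (arc-cases : ∀ i → i ∈ proj₁ qp ∷ proj₁ pr ∷ proj₁ rq ∷ proj₁ ps ∷ proj₁ sq ∷ []) where

  open Graph G
  open Arcs F using (_⟶_)
  open Frame F using (A; B; cover; src; joins; joins-sym; mate; mate-joins)

  -- Listed in the numbering of `Θ`: `A p` and `B q` are its branch vertices. In `es` the first row
  -- is the path through the spine, and the other two rows are the pages `r` and `s`.
  vs : List Vertex
  vs = A p ∷ B q ∷ B p ∷ A q ∷ B r ∷ A r ∷ B s ∷ A s ∷ []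

  edge : ∀ {x y} → x ⟶ y → Edge
  edge (i , _) = arc F i

  es : List Edge
  es = mate p ∷ edge qp ∷ mate q
     ∷ edge pr ∷ mate r ∷ edge rq
     ∷ edge ps ∷ mate s ∷ edge sq ∷ []

  vs-complete : ∀ v → v ∈ vs
  vs-complete v with cover v
  ... | inj₁ (x , refl) with corner x
  ...   | here refl                         = ∈-lookup {xs = vs} 0F
  ...   | there (here refl)                 = ∈-lookup {xs = vs} 3F
  ...   | there (there (here refl))         = ∈-lookup {xs = vs} 5F
  ...   | there (there (there (here refl))) = ∈-lookup {xs = vs} 7F
  vs-complete v | inj₂ (x , refl) with corner x
  ...   | here refl                         = ∈-lookup {xs = vs} 2F
  ...   | there (here refl)                 = ∈-lookup {xs = vs} 1F
  ...   | there (there (here refl))         = ∈-lookup {xs = vs} 4F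
  ...   | there (there (there (here refl))) = ∈-lookup {xs = vs} 6F

  mate∈ : ∀ x → mate x ∈ es
  mate∈ x with corner x
  ... | here refl                         = ∈-lookup {xs = es} 0F
  ... | there (here refl)                 = ∈-lookup {xs = es} 2F
  ... | there (there (here refl))         = ∈-lookup {xs = es} 4F
  ... | there (there (there (here refl))) = ∈-lookup {xs = es} 7F

  arc∈ : ∀ i → arc F i ∈ es
  arc∈ i with arc-cases i
  ... | here refl                                 = ∈-lookup {xs = es} 1F
  ... | there (here refl)                         = ∈-lookup {xs = es} 3F
  ... | there (there (here refl))                 = ∈-lookup {xs = es} 5F
  ... | there (there (there (here refl)))         = ∈-lookup {xs = es} 6F
  ... | there (there (there (there (here refl)))) = ∈-lookup {xs = es} 8F

  es-complete : ∀ e → e ∈ es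
  es-complete e with mate⊎arc F e
  ... | inj₁ eq         = subst (_∈ es) eq (mate∈ (src e))
  ... | inj₂ (i , refl) = arc∈ i

  arc-joins : ∀ {x y} (a : x ⟶ y) → Joins (edge a) (A x) (B y)
  arc-joins (i , refl , refl) = joins (arc F i)

  es-joins : ∀ f → let u , v = Graph.ends Θ f in Joins (lookup es f) (lookup vs u) (lookup vs v)
  es-joins 0F = mate-joins p
  es-joins 1F = joins-sym (arc-joins qp)
  es-joins 2F = mate-joins q
  es-joins 3F = arc-joins pr
  es-joins 4F = joins-sym (mate-joins r)
  es-joins 5F = arc-joins rq
  es-joins 6F = arc-joins ps
  es-joins 7F = joins-sym (mate-joins s)
  es-joins 8F = arc-joins sq

  isomorphism : G ≅ Θ
  isomorphism = surjections⇒≅ (lookup vs) (lookup es) order≡8 size≡9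
    (λ v → index (vs-complete v) , sym (lookup-index (vs-complete v)))
    (λ e → index (es-complete e) , sym (lookup-index (es-complete e)))
    es-joins

module Extremal (G : Graph) (F : Frame G) (covered : Graph.MatchingCovered G) (minimal : Minimal G)
                (edge-extremal : 2 * Graph.size G + 6 ≡ 3 * Graph.order G)
                (vertex-extremal : 2 * length (Graph.V₂ G) ≡ Graph.order G + 4) where

  open Graph G
  open Frame F
  open Reduction minimal covered

  k : ℕ
  k = arcs F

  sparse : k + 3 ≡ nodes + nodes
  sparse = *-cancelˡ-≡ (k + 3) (nodes + nodes) 2 (+-cancelˡ-≡ (2 * nodes) _ _ (begin
    2 * nodes + 2 * (k + 3)           ≡⟨ left nodes k ⟩
    2 * (nodes + k) + 6               ≡⟨ cong (λ m → 2 * m + 6) (size≡ F) ⟨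
    2 * size + 6                      ≡⟨ edge-extremal ⟩
    3 * order                         ≡⟨ cong (3 *_) (order≡ F) ⟩
    3 * (nodes + nodes)               ≡⟨ right nodes ⟩
    2 * nodes + 2 * (nodes + nodes)   ∎))
    where
    open ≡-Reasoning
    left : ∀ n k → 2 * n + 2 * (k + 3) ≡ 2 * (n + k) + 6
    left = solve-∀
    right : ∀ n → 3 * (n + n) ≡ 2 * n + 2 * (n + n)
    right = solve-∀

  strong : Arcs.StronglyConnected F
  strong = arcs-strong F (covered⇒strong covered)

  2≤nodes : 2 ≤ nodes
  2≤nodes = *-cancelˡ-≤ 2 (≤-trans (proj₁ (proj₂ covered))
    (≤-reflexive (trans (order≡ F) (double nodes))))
    where
    double : ∀ n → n + n ≡ 2 * n
    double = solve-∀

  -- Every node has an outgoing arc, so `nodes ≤ k`, and `sparse` turns this into the bound. The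
  -- digon argument needs a third node.
  3≤nodes : 3 ≤ nodes
  3≤nodes = +-cancelˡ-≤ nodes 3 nodes (≤-trans
    (+-monoˡ-≤ 3 (nodes≤arcs (src ∘ arc F) (tgt ∘ arc F) strong 2≤nodes)) (≤-reflexive sparse))

  arc-irredundant : Arcs.Irredundant F
  arc-irredundant i detour = irredundant F (arc F i) (arc-free F i)
    (Star.map (λ (j , j≢i , eqs) → arc F j , j≢i ∘ arc-injective F , eqs) detour)

  open Arcs.Sparse F strong arc-irredundant sparse

  arc-no-digon : ∀ {x y} → Arcs._⟶_ F x y → ¬ Arcs._⟶_ F y x
  arc-no-digon {x} {y} (i , s , t) (j , s′ , t′) =
    no-digon F {arc F i} {arc F j} {proj₁ third} (arc-free F i) (arc-free F j)
      (trans s (sym t′)) (trans t (sym s′))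
      (λ z≡ → proj₂ third (here (trans z≡ s))) (λ z≡ → proj₂ third (there (here (trans z≡ t))))
    where
    third : ∃[ z ] z ∉ x ∷ y ∷ []
    third = length<⇒missing 3≤nodes

  open NoDigon arc-no-digon

  A-degree : ∀ x → (∀ {u v} → Arcs._⟶_ F x u → Arcs._⟶_ F x v → u ≡ v) → degree (A x) ≡ 2
  A-degree x out-unique = at (out-arc (src ∘ arc F) (tgt ∘ arc F) strong 2≤nodes x)
    where
    at : (∃[ i ] src (arc F i) ≡ x) → degree (A x) ≡ 2
    at (i , s) = subst (λ x → degree (A x) ≡ 2) s (degree-A F i λ j sj →
      arc-unique j i sj (out-unique (j , trans sj s , refl) (i , s , refl)))

  B-degree : ∀ x → (∀ {u v} → Arcs._⟶_ F u x → Arcs._⟶_ F v x → u ≡ v) → degree (B x) ≡ 2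
  B-degree x in-unique = at (in-arc (src ∘ arc F) (tgt ∘ arc F) strong 2≤nodes x)
    where
    at : (∃[ i ] tgt (arc F i) ≡ x) → degree (B x) ≡ 2
    at (i , t) = subst (λ x → degree (B x) ≡ 2) t (degree-B F i λ j tj →
      arc-unique j i (in-unique (j , refl , trans tj t) (i , refl , t)) tj)

  -- With N nodes there are 2N vertices, of which N + 2 have degree two, so 2N ≤ `length vs` + N +
  -- 2.
  few-branches : ∀ vs → (∀ v → v ∈ vs ++ V₂) → nodes ≤ 2 + length vs
  few-branches vs all∈ = *-cancelˡ-≤ 2 (+-cancelˡ-≤ (2 * nodes) _ _ (begin
    2 * nodes + 2 * nodes              ≡⟨ split nodes ⟩
    2 * (nodes + nodes)                ≡⟨ cong (2 *_) (order≡ F) ⟨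
    2 * order                          ≤⟨ *-monoʳ-≤ 2 (complete⇒length≥ all∈) ⟩
    2 * length (vs ++ V₂)              ≡⟨ cong (2 *_) (length-++ vs) ⟩
    2 * (length vs + length V₂)        ≡⟨ *-distribˡ-+ 2 (length vs) (length V₂) ⟩
    2 * length vs + 2 * length V₂      ≡⟨ cong (2 * length vs +_) vertex-extremal ⟩
    2 * length vs + (order + 4)        ≡⟨ cong (λ n → 2 * length vs + (n + 4)) (order≡ F) ⟩
    2 * length vs + (nodes + nodes + 4) ≡⟨ collect (length vs) nodes ⟩
    2 * nodes + 2 * (2 + length vs)    ∎))
    where
    open ≤-Reasoning
    split : ∀ n → 2 * n + 2 * n ≡ 2 * (n + n)
    split = solve-∀
    collect : ∀ l n → 2 * l + (n + n + 4) ≡ 2 * n + 2 * (2 + l)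
    collect = solve-∀

  -- Without branch vertices the count gives N ≤ 2.
  not-functional : ¬ Functional
  not-functional (out-unique , in-unique) = <⇒≱ 3≤nodes (few-branches [] all∈)
    where
    all∈ : ∀ v → v ∈ V₂
    all∈ v with cover v
    ... | inj₁ (x , refl) = ∈-V₂ {G = G} (A-degree x out-unique)
    ... | inj₂ (x , refl) = ∈-V₂ {G = G} (B-degree x in-unique)

  book⇒Θ : Book → G ≅ Θ
  book⇒Θ book = Layout.isomorphism F order≡8 size≡9 corner qp pr rq ps sq arc-cases
    where
    open Book book

    -- The four distinct corners give one inequality; the two possible branch vertices `A p` and
    -- `B q` give the other.
    4≡nodes : 4 ≡ nodes
    4≡nodes = ≤-antisym (Unique⇒length≤ corners-Unique) (few-branches (A p ∷ B q ∷ []) all∈)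
      where
      all∈A : ∀ x → A x ∈ A p ∷ B q ∷ V₂
      all∈A x with x ≟ p
      ... | yes x≡p = here (cong A x≡p)
      ... | no x≢p  = there (there (∈-V₂ {G = G} (A-degree x (out-unique x≢p))))
      all∈B : ∀ x → B x ∈ A p ∷ B q ∷ V₂
      all∈B x with x ≟ q
      ... | yes x≡q = there (here (cong B x≡q))
      ... | no x≢q  = there (there (∈-V₂ {G = G} (B-degree x (in-unique x≢q))))
      all∈ : ∀ v → v ∈ A p ∷ B q ∷ V₂
      all∈ v with cover v
      ... | inj₁ (x , refl) = all∈A x
      ... | inj₂ (x , refl) = all∈B x

    order≡8 : order ≡ 8
    order≡8 = trans (order≡ F) (cong (λ n → n + n) (sym 4≡nodes))

    size≡9 : size ≡ 9
    size≡9 = trans (size≡ F) (cong₂ _+_ (sym 4≡nodes)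
      (+-cancelʳ-≡ 3 k 5 (trans sparse (cong (λ n → n + n) (sym 4≡nodes)))))

    corner : ∀ x → x ∈ p ∷ q ∷ r ∷ s ∷ []
    corner = Unique∧length≡⇒complete corners-Unique 4≡nodes

    as : List (Fin k)
    as = proj₁ qp ∷ proj₁ pr ∷ proj₁ rq ∷ proj₁ ps ∷ proj₁ sq ∷ []

    page : ∀ {x} → x ∈ p ∷ q ∷ r ∷ s ∷ [] → x ≢ p → x ≢ q → x ≡ r ⊎ x ≡ s
    page (here x≡p)                         x≢p _   = contradiction x≡p x≢p
    page (there (here x≡q))                 _   x≢q = contradiction x≡q x≢q
    page (there (there (here x≡r)))         _   _   = inj₁ x≡r
    page (there (there (there (here x≡s)))) _   _   = inj₂ x≡s

    same : ∀ {i x y} (a : Arcs._⟶_ F x y) → src (arc F i) ≡ x → tgt (arc F i) ≡ y → i ≡ proj₁ a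
    same {i} (j , s , t) s′ t′ = arc-unique i j (trans s′ (sym s)) (trans t′ (sym t))

    from-p : ∀ {i} → src (arc F i) ≡ p → tgt (arc F i) ≡ r ⊎ tgt (arc F i) ≡ s → i ∈ as
    from-p s′ (inj₁ t′) = there (here (same pr s′ t′))
    from-p s′ (inj₂ t′) = there (there (there (here (same ps s′ t′))))

    into-q : ∀ {i} → tgt (arc F i) ≡ q → src (arc F i) ≡ r ⊎ src (arc F i) ≡ s → i ∈ as
    into-q t′ (inj₁ s′) = there (there (here (same rq s′ t′)))
    into-q t′ (inj₂ s′) = there (there (there (there (here (same sq s′ t′)))))

    arc-cases : ∀ i → i ∈ as
    arc-cases i = cases (classify (i , refl , refl))
      where
      u = src (arc F i)
      v = tgt (arc F i)
      cases : (u ≡ q × v ≡ p) ⊎ (u ≡ p × Arcs._⟶_ F v q) ⊎ (v ≡ q × Arcs._⟶_ F p u) → i ∈ as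
      cases (inj₁ (u≡q , v≡p)) = here (same qp u≡q v≡p)
      cases (inj₂ (inj₁ (u≡p , vq))) = from-p u≡p (page (corner v)
        (λ v≡p → no-loop (i , u≡p , v≡p)) (λ v≡q → no-loop (subst (λ z → Arcs._⟶_ F z q) v≡q vq)))
      cases (inj₂ (inj₂ (v≡q , pu))) = into-q v≡q (page (corner u)
        (λ u≡p → no-loop (subst (Arcs._⟶_ F p) u≡p pu)) (λ u≡q → no-loop (i , u≡q , v≡q)))

  conclusion : G ≅ Θ
  conclusion = [ ⊥-elim ∘ not-functional , book⇒Θ ] (structure (proj₂ other ∘ here))
    where
    x : Fin nodes
    x = proj₁ (length<⇒missing {xs = []} (≤-trans (s≤s z≤n) 3≤nodes))
    other : ∃[ z ] z ∉ x ∷ []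
    other = length<⇒missing 2≤nodes

extremal⇒Θ : ∀ {G} → H₄ G → H₃ G → G ≅ Θ
extremal⇒Θ {G} ((bipartite , covered , minimal) , edge-extremal) (_ , vertex-extremal) =
  Extremal.conclusion G (bipartite⇒frame G bipartite matching)
    covered minimal edge-extremal vertex-extremal
  where
  open Graph G
  -- Two distinct vertices of a connected graph yield an edge, and the perfect matching through it
  -- is taken.
  matching : ∃[ M ] PerfectMatching M
  matching = ofEdge (edge (proj₁ covered u (proj₁ other)) (proj₂ other ∘ here ∘ sym))
    where
    u : Vertex
    u = proj₁ (length<⇒missing {xs = []} (≤-trans (s≤s z≤n) (proj₁ (proj₂ covered))))
    other : ∃[ v ] v ∉ u ∷ []
    other = length<⇒missing (≤-trans (s≤s (s≤s z≤n)) (proj₁ (proj₂ covered)))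
    edge : ∀ {u v} → Star Adjacent u v → u ≢ v → Edge
    edge ε             u≢u = contradiction refl u≢u
    edge ((e , _) ◅ _) _   = e
    ofEdge : Edge → ∃[ M ] PerfectMatching M
    ofEdge e with M , perfect , _ ← proj₂ (proj₂ covered) e = M , perfect

-- Isomorphism and the graph Θ

length-filter-≤ : ∀ {m n} {P : Fin m → Set} {Q : Fin n → Set} (P? : Decidable P) (Q? : Decidable Q)
  (f : Fin m → Fin n) → (∀ {x y} → f x ≡ f y → x ≡ y) → (∀ {x} → P x → Q (f x)) →
  length (filter P? (allFin m)) ≤ length (filter Q? (allFin n))
length-filter-≤ {m} P? Q? f f-injective P⇒Q = ≤-trans
  (≤-reflexive (sym (length-map f (filter P? (allFin m)))))
  (Unique-⊆⇒length≤ (map⁺ f-injective (filter⁺ P? (allFin⁺ m))) λ y∈ → kept (∈-map⁻ f y∈))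
  where
  kept : ∀ {y} → (∃[ x ] x ∈ filter P? (allFin m) × y ≡ f x) → y ∈ filter Q? (allFin _)
  kept (x , x∈ , refl) =
    ∈-filter⁺ Q? (∈-allFin (f x)) (P⇒Q (proj₂ (∈-filter⁻ P? {xs = allFin m} x∈)))

-- An isomorphism preserves `Joins` in one direction only by definition. The converse holds because
-- the ends of `e` are the images of the ends of `fromE e`, and an edge has only one pair of ends.
≅-sym : ∀ {G H} → G ≅ H → H ≅ G
≅-sym {G} {H} G≅H = record
  { vertices = ↔-sym vertices ; edges = ↔-sym edges ; joins = λ {e} → back e }
  where
  open _≅_ G≅H
  module G = Graph G
  module H = Graph H
  fromV = Inverse.from vertices
  fromE = Inverse.from edges
  fromto : ∀ {v} → fromV (Inverse.to vertices v) ≡ v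
  fromto = Inverse.inverseʳ vertices refl
  back : ∀ e {u v} → H.Joins e u v → G.Joins (fromE e) (fromV u) (fromV v)
  back e e∈uv = compare e∈uv
    (subst (λ e → H.Joins e _ _) (Inverse.inverseˡ edges refl) (joins (inj₁ refl)))
    where
    a = proj₁ (G.ends (fromE e))
    b = proj₂ (G.ends (fromE e))
    compare : ∀ {u v} → H.Joins e u v → H.Joins e (Inverse.to vertices a) (Inverse.to vertices b) →
              G.Joins (fromE e) (fromV u) (fromV v)
    compare (inj₁ p) (inj₁ q) with refl ← trans (sym p) q =
      inj₁ (cong₂ _,_ (sym fromto) (sym fromto))
    compare (inj₁ p) (inj₂ q) with refl ← trans (sym p) q =
      inj₂ (cong₂ _,_ (sym fromto) (sym fromto))
    compare (inj₂ p) (inj₁ q) with refl ← trans (sym p) q =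
      inj₂ (cong₂ _,_ (sym fromto) (sym fromto))
    compare (inj₂ p) (inj₂ q) with refl ← trans (sym p) q =
      inj₁ (cong₂ _,_ (sym fromto) (sym fromto))

module Transfer {G H : Graph} (G≅H : G ≅ H) where

  open _≅_ G≅H
  module G = Graph G
  module H = Graph H
  open Inverse vertices using () renaming (to to toV; from to fromV)
  open Inverse edges using () renaming (to to toE; from to fromE)

  toV-injective : ∀ {u v} → toV u ≡ toV v → u ≡ v
  toV-injective eq = trans (sym (Inverse.inverseʳ vertices refl)) (Inverse.inverseʳ vertices eq)

  toE-injective : ∀ {e f} → toE e ≡ toE f → e ≡ f
  toE-injective eq = trans (sym (Inverse.inverseʳ edges refl)) (Inverse.inverseʳ edges eq)

  incident : ∀ {v e} → G.Incident v e → H.Incident (toV v) (toE e)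
  incident {e = e} v∈e with v∈e | joins {e} (inj₁ refl)
  ... | inj₁ refl | inj₁ eq = inj₁ (cong proj₁ eq)
  ... | inj₁ refl | inj₂ eq = inj₂ (cong proj₂ eq)
  ... | inj₂ refl | inj₁ eq = inj₂ (cong proj₂ eq)
  ... | inj₂ refl | inj₂ eq = inj₁ (cong proj₁ eq)

  order≡ᴴ : G.order ≡ H.order
  order≡ᴴ = Perm.↔⇒≡ vertices

  size≡ᴴ : G.size ≡ H.size
  size≡ᴴ = Perm.↔⇒≡ edges

  degree-≤ : ∀ v → G.degree v ≤ H.degree (toV v)
  degree-≤ v = length-filter-≤ (G.incident? v) (H.incident? (toV v)) toE toE-injective incident

  bipartite : H.Bipartite → G.Bipartite
  bipartite (colour , proper) = colour ∘ toV , λ e same → go e same (joins {e} (inj₁ refl))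
    where
    go : ∀ e → colour (toV (proj₁ (G.ends e))) ≡ colour (toV (proj₂ (G.ends e))) →
         ¬ H.Joins (toE e) (toV (proj₁ (G.ends e))) (toV (proj₂ (G.ends e)))
    go e same (inj₁ eq) = proper (toE e) (trans (cong (colour ∘ proj₁) eq)
      (trans same (cong colour (sym (cong proj₂ eq)))))
    go e same (inj₂ eq) = proper (toE e) (trans (cong (colour ∘ proj₁) eq)
      (trans (sym same) (cong colour (sym (cong proj₂ eq)))))

module _ {G H : Graph} (G≅H : G ≅ H) where

  private
    module G = Graph G
    module H = Graph H
    module To   = Transfer G≅H
    module From = Transfer (≅-sym G≅H)
  open _≅_ G≅H
  open Inverse vertices using () renaming (to to toV; from to fromV)
  open Inverse edges using () renaming (to to toE; from to fromE)

  from-toV : ∀ {v} → fromV (toV v) ≡ v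
  from-toV = Inverse.inverseʳ vertices refl

  degree-≅ : ∀ v → G.degree v ≡ H.degree (toV v)
  degree-≅ v = ≤-antisym (To.degree-≤ v)
    (≤-trans (From.degree-≤ (toV v)) (≤-reflexive (cong G.degree from-toV)))

  V₂-≤ : length G.V₂ ≤ length H.V₂
  V₂-≤ = length-filter-≤ (λ v → G.degree v ℕ.≟ 2) (λ v → H.degree v ℕ.≟ 2) toV To.toV-injective
    λ {v} eq → trans (sym (degree-≅ v)) eq

  perfect-≅ : ∀ {M} → H.PerfectMatching M → G.PerfectMatching (subset λ e → toE e ∈ˢ? M)
  perfect-≅ {M} perfect v with f , (f∈M , v∈f) , unique ← perfect (toV v) =
    fromE f
    , ( ∈-subset⁺ (λ e → toE e ∈ˢ? M) (subst (Subset._∈ M) (sym (Inverse.inverseˡ edges refl)) f∈M)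
      , subst (λ v → G.Incident v (fromE f)) from-toV (From.incident v∈f))
    , λ (e∈ , v∈e) → Inverse.inverseʳ edges
        (unique (∈-subset⁻ (λ e → toE e ∈ˢ? M) e∈ , To.incident v∈e))

  covered-≅ : H.MatchingCovered → G.MatchingCovered
  covered-≅ (connected , 4≤n , matched) =
    (λ u v → subst₂ (Star G.Adjacent) from-toV from-toV
      (Star.gmap fromV (λ (e , j) → fromE e , _≅_.joins (≅-sym G≅H) j) (connected (toV u) (toV v))))
    , subst (4 ≤_) (sym To.order≡ᴴ) 4≤n
    , λ e → let M , perfect , e∈M = matched (toE e)
            in _ , perfect-≅ perfect , ∈-subset⁺ (λ e → toE e ∈ˢ? M) e∈M

-- Deletion renumbers the edges by `punchIn`, and `Perm.remove` is the edge bijection compatible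
-- with this on both sides.
delete-≅ : ∀ {G H} (G≅H : G ≅ H) e → (G -ₑ e) ≅ (H -ₑ Inverse.to (_≅_.edges G≅H) e)
delete-≅ {record { size = zero }} _ ()
delete-≅ {record { size = suc _ }} {record { size = zero }} G≅H e
  with () ← Inverse.to (_≅_.edges G≅H) e
delete-≅ {record { size = suc _ }} {H@record { size = suc _ }} G≅H e = record
  { vertices = vertices
  ; edges    = Perm.remove e edges
  ; joins    = λ {f} {u} {v} f∈uv → subst
      (λ f → Graph.Joins H f (Inverse.to vertices u) (Inverse.to vertices v))
      (Perm.punchIn-permute edges e f) (joins f∈uv)
  }
  where open _≅_ G≅H

minimal-≅ : ∀ {G H} → G ≅ H → Minimal H → Minimal G
minimal-≅ G≅H minimal e covered =
  minimal (Inverse.to (_≅_.edges G≅H) e) (covered-≅ (≅-sym (delete-≅ G≅H e)) covered)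

extremal-≅ : ∀ {G H} → G ≅ H → H₄ H × H₃ H → H₄ G × H₃ G
extremal-≅ {G} {H} G≅H ((mbmc@(bipartite , covered , minimal) , size-eq) , _ , V₂-eq) =
  (mbmcᴳ , trans (cong (λ m → 2 * m + 6) size≡ᴴ) (trans size-eq (cong (3 *_) (sym order≡ᴴ)))) ,
  (mbmcᴳ , trans (cong (2 *_) V₂≡) (trans V₂-eq (cong (_+ 4) (sym order≡ᴴ))))
  where
  open Transfer G≅H using (order≡ᴴ; size≡ᴴ)
  V₂≡ : length (Graph.V₂ G) ≡ length (Graph.V₂ H)
  V₂≡ = ≤-antisym (V₂-≤ G≅H) (V₂-≤ (≅-sym G≅H))
  mbmcᴳ : MinimalBipartiteMatchingCovered G
  mbmcᴳ = Transfer.bipartite G≅H bipartite , covered-≅ G≅H covered , minimal-≅ G≅H minimal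

-- An edge g sharing an end w with the only edge f at v lies in no perfect matching.
pendant⇒uncovered : ∀ G → let open Graph G in ∀ {v w f g} →
  (∀ h → Incident v h → h ≡ f) → Incident w f → Incident w g → g ≢ f → ¬ MatchingCovered
pendant⇒uncovered G {v} {w} {f} {g} only w∈f w∈g g≢f (_ , _ , matched)
  with M , perfect , g∈M ← matched g
  with h , (h∈M , v∈h) , _ ← perfect v | _ , _ , unique ← perfect w
  with refl ← only h v∈h = g≢f (trans (sym (unique (g∈M , w∈g))) (unique (h∈M , w∈f)))

-- Membership of Θ in both classes

Θ-bipartite : Graph.Bipartite Θ
Θ-bipartite = Vec.lookup colours , from-yes (all? λ e →
  ¬? (Vec.lookup colours (proj₁ (ends e)) Bool.≟ Vec.lookup colours (proj₂ (ends e))))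
  where
  open Graph Θ using (ends)
  colours = true ∷ false ∷ false ∷ true ∷ false ∷ true ∷ false ∷ true ∷ []

-- The labelling of `Layout` with `p`, `q`, `r`, `s` numbered 0, 1, 2, 3.
Θ-frame : Frame Θ
Θ-frame = record
  { A = A ; B = B
  ; A-injective = λ {x} {y} → from-yes (all? λ x → all? λ y → (A x ≟ A y) →-dec (x ≟ y)) x y
  ; B-injective = λ {x} {y} → from-yes (all? λ x → all? λ y → (B x ≟ B y) →-dec (x ≟ y)) x y
  ; A≢B = λ {x} {y} → from-yes (all? λ x → all? λ y → ¬? (A x ≟ B y)) x y
  ; cover = from-yes (all? λ v → any? (λ x → A x ≟ v) ⊎-dec any? (λ x → B x ≟ v))
  ; src = src ; tgt = tgt
  ; joins = λ where
      0F → inj₁ refl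
      1F → inj₂ refl
      2F → inj₁ refl
      3F → inj₁ refl
      4F → inj₂ refl
      5F → inj₁ refl
      6F → inj₁ refl
      7F → inj₂ refl
      8F → inj₁ refl
  ; mate = mate
  ; src-mate = from-yes (all? λ x → src (mate x) ≟ x)
  ; tgt-mate = from-yes (all? λ x → tgt (mate x) ≟ x)
  }
  where
  A B : Fin 4 → Fin 8
  A = Vec.lookup (0F ∷ 3F ∷ 5F ∷ 7F ∷ [])
  B = Vec.lookup (2F ∷ 1F ∷ 4F ∷ 6F ∷ [])
  src tgt : Fin 9 → Fin 4
  src = Vec.lookup (0F ∷ 1F ∷ 1F ∷ 0F ∷ 2F ∷ 2F ∷ 0F ∷ 3F ∷ 3F ∷ [])
  tgt = Vec.lookup (0F ∷ 0F ∷ 1F ∷ 2F ∷ 2F ∷ 1F ∷ 3F ∷ 3F ∷ 1F ∷ [])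
  mate : Fin 4 → Fin 9
  mate = Vec.lookup (0F ∷ 2F ∷ 4F ∷ 7F ∷ [])

Θ-covered : Graph.MatchingCovered Θ
Θ-covered = strong⇒covered (s≤s (s≤s (s≤s (s≤s z≤n)))) λ x y → toHub x ◅◅ fromHub y
  where
  open Frame Θ-frame
  toHub : ∀ x → Star _⟶_ x 0F
  toHub 0F = ε
  toHub 1F = (1F , refl , refl) ◅ ε
  toHub 2F = (5F , refl , refl) ◅ (1F , refl , refl) ◅ ε
  toHub 3F = (8F , refl , refl) ◅ (1F , refl , refl) ◅ ε
  fromHub : ∀ x → Star _⟶_ 0F x
  fromHub 0F = ε
  fromHub 1F = (3F , refl , refl) ◅ (5F , refl , refl) ◅ ε
  fromHub 2F = (3F , refl , refl) ◅ ε
  fromHub 3F = (6F , refl , refl) ◅ ε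

-- Each edge e of Θ has an end v of degree two. In Θ -ₑ e, whose edges are
-- renumbered, f is the other edge at v, w its other end and g another edge at w.
Θ-minimal : Minimal Θ
Θ-minimal e = pendant⇒uncovered (Θ -ₑ e) {v e} {w e} {f e} {g e}
  (only e) (proj₁ (shared e)) (proj₁ (proj₂ (shared e))) (proj₂ (proj₂ (shared e)))
  where
  v w : Fin 9 → Fin 8
  v = Vec.lookup (2F ∷ 2F ∷ 3F ∷ 4F ∷ 4F ∷ 5F ∷ 6F ∷ 6F ∷ 7F ∷ [])
  w = Vec.lookup (3F ∷ 0F ∷ 2F ∷ 5F ∷ 0F ∷ 4F ∷ 7F ∷ 0F ∷ 6F ∷ [])
  f g : Fin 9 → Fin 8
  f = Vec.lookup (0F ∷ 0F ∷ 1F ∷ 3F ∷ 3F ∷ 4F ∷ 6F ∷ 6F ∷ 7F ∷ [])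
  g = Vec.lookup (1F ∷ 2F ∷ 0F ∷ 4F ∷ 0F ∷ 3F ∷ 7F ∷ 0F ∷ 6F ∷ [])
  only : ∀ e h → Graph.Incident (Θ -ₑ e) (v e) h → h ≡ f e
  only = from-yes (all? λ e → all? λ h → Graph.incident? (Θ -ₑ e) (v e) h →-dec (h ≟ f e))
  shared : ∀ e → let open Graph (Θ -ₑ e) in
           Incident (w e) (f e) × Incident (w e) (g e) × g e ≢ f e
  shared = from-yes (all? λ e → Graph.incident? (Θ -ₑ e) (w e) (f e)
    ×-dec Graph.incident? (Θ -ₑ e) (w e) (g e) ×-dec ¬? (g e ≟ f e))

Θ-extremal : H₄ Θ × H₃ Θ
Θ-extremal = (Θ-mbmc , refl) , (Θ-mbmc , refl)
  where
  Θ-mbmc : MinimalBipartiteMatchingCovered Θ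
  Θ-mbmc = Θ-bipartite , Θ-covered , Θ-minimal

corollary7p5 : H₄ ∩ H₃ ≐ (_≅ Θ)
corollary7p5 = (λ (h₄ , h₃) → extremal⇒Θ h₄ h₃) , λ G≅Θ → extremal-≅ G≅Θ Θ-extremal
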